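{- Let $G$ be a connected input graph, and let $\ell$ be the size of a chordal deletion of $G$. If $\mathcal{O}^*(f(\ell))$ is the running time of an algorithm computing a chordal deletion of size $\ell$ of a graph, then INDEPENDENT CUTSET can be solved in $\mathcal{O}^*(f(\ell)+3^\ell)$ time.
   Context: All graphs are finite, simple, loopless and undirected. A set $S$ of vertices of a graph $G$ is a cutset of $G$ if $G-S$ is disconnected; it is an independent set if its vertices are pairwise nonadjacent. An independent cutset of $G$ is a set of vertices that is both a cutset and an independent set of $G$. INDEPENDENT CUTSET is the decision problem: given a connected graph $G$, does $G$ have an independent cutset? A graph is chordal if every induced cycle has length exactly three. A chordal deletion of $G$ is a set of vertices $X$ such that $G-X$ is chordal. The notation $\mathcal{O}^*$ is the $\mathcal{O}$-notation with factors polynomial in the input size suppressed. -}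

module Defs where

open import Data.Bool using (Bool; true; false; T)
open import Data.Fin using (Fin; toℕ)
open import Data.Fin.Subset using (Subset; _∈_; ∁; ∣_∣)
open import Data.List using (List; []; _∷_; map; replicate; tabulate)
open import Data.Nat using (ℕ; suc; _+_; _*_; _^_; _≤_)
open import Data.Product using (Σ; _×_; _,_; ∃; ∃₂; proj₁)
open import Data.Sum using (_⊎_)
open import Data.Vec using (Vec; []; _∷_; lookup; toList)
open import Function.Base using (_on_)
open import Function.Bundles using (_⇔_)
open import Function.Definitions using (Injective)
open import Relation.Binary.Construct.Closure.ReflexiveTransitive using (Star)
open import Relation.Binary.PropositionalEquality using (_≡_; refl)
open import Relation.Nullary using (¬_)

record Graph (V : Set) : Set where
  field
    adj    : V → V → Bool
    irrefl : ∀ v → ¬ T (adj v v)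
    sym    : ∀ {u v} → T (adj u v) → T (adj v u)

  Adj : V → V → Set
  Adj u v = T (adj u v)

open Graph using (Adj)

-- Membership in `∁ S` is proof-irrelevant, so equality of vertices of `G − S`
-- is equality of the underlying vertices of G.
infixl 6 _−_
_−_ : ∀ {n} → Graph (Fin n) → (S : Subset n) → Graph (Σ (Fin n) (_∈ ∁ S))
G − S = record
  { adj    = Graph.adj G on proj₁
  ; irrefl = λ v → Graph.irrefl G (proj₁ v)
  ; sym    = Graph.sym G
  }

-- The graph without vertices counts as connected: a disconnected graph has
-- two vertices that are not joined by a path.
Connected : ∀ {V} → Graph V → Set
Connected G = ∀ u v → Star (Adj G) u v

IsCutset : ∀ {n} → Graph (Fin n) → Subset n → Set
IsCutset G S = ¬ Connected (G − S)

IsIndependent : ∀ {n} → Graph (Fin n) → Subset n → Set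
IsIndependent G S = ∀ {u v} → u ∈ S → v ∈ S → ¬ Adj G u v

HasIndependentCutset : ∀ {n} → Graph (Fin n) → Set
HasIndependentCutset G = ∃ λ S → IsCutset G S × IsIndependent G S

-- j is the successor of i in the cyclic order 0, 1, …, k-1, 0.
Next : ∀ {k} → Fin k → Fin k → Set
Next {k} i j = (toℕ j ≡ suc (toℕ i)) ⊎ (suc (toℕ i) ≡ k × toℕ j ≡ 0)

record InducedCycle {V : Set} (G : Graph V) (k : ℕ) : Set where
  field
    3≤k       : 3 ≤ k
    vertex    : Fin k → V
    injective : Injective _≡_ _≡_ vertex
    adjacency : ∀ i j → Adj G (vertex i) (vertex j) ⇔ (Next i j ⊎ Next j i)

Chordal : ∀ {V} → Graph V → Set
Chordal G = ∀ {k} → InducedCycle G k → k ≡ 3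

IsChordalDeletion : ∀ {n} → Graph (Fin n) → Subset n → Set
IsChordalDeletion G X = Chordal (G − X)

HasChordalDeletionOfSize : ∀ {n} → Graph (Fin n) → ℕ → Set
HasChordalDeletionOfSize G ℓ = ∃ λ X → ∣ X ∣ ≡ ℓ × IsChordalDeletion G X

-- The model of computation: a first-order, call-by-value functional language
-- over binary trees, as in N. D. Jones, "Computability and Complexity from a
-- Programming Perspective".  An algorithm is a finite program, uniform in the
-- input.  Every evaluation step costs 1 and is a constant-time operation on
-- pointers (trees are shared, never copied, and environments have a length
-- bounded by the program), so running times agree with those on a random
-- access machine up to factors polylogarithmic in the running time.  For
-- running times at most exponential in a polynomial of the input size, these
-- factors are polynomial in the input size, so O* suppresses them.
data Tree : Set where
  nil : Tree
  _∙_ : Tree → Tree → Tree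

size : Tree → ℕ
size nil     = 1
size (x ∙ y) = suc (size x + size y)

-- `Exp k m`: expressions calling k global unary functions, with m variables in
-- scope (de Bruijn).  `case e e₀ e₁` is e₀ if e is nil; if e is x ∙ y, it is e₁
-- with x as variable 0 and y as variable 1.
data Exp (k : ℕ) : ℕ → Set where
  var   : ∀ {m} → Fin m → Exp k m
  nil   : ∀ {m} → Exp k m
  _∙_   : ∀ {m} → Exp k m → Exp k m → Exp k m
  case  : ∀ {m} → Exp k m → Exp k m → Exp k (suc (suc m)) → Exp k m
  bind  : ∀ {m} → Exp k m → Exp k (suc m) → Exp k m
  call  : ∀ {m} → Fin k → Exp k m → Exp k m

record Program : Set where
  field
    functions : ℕ
    body      : Fin functions → Exp functions 1
    main      : Exp functions 1

-- `Eval body ρ e v t`: in the environment ρ, e has value v, computed in t steps.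
data Eval {k} (body : Fin k → Exp k 1) :
          ∀ {m} → Vec Tree m → Exp k m → Tree → ℕ → Set where
  var      : ∀ {m} {ρ : Vec Tree m} i → Eval body ρ (var i) (lookup ρ i) 1
  nil      : ∀ {m} {ρ : Vec Tree m} → Eval body ρ nil nil 1
  _∙_      : ∀ {m} {ρ : Vec Tree m} {e₀ e₁ x y s t} →
             Eval body ρ e₀ x s → Eval body ρ e₁ y t →
             Eval body ρ (e₀ ∙ e₁) (x ∙ y) (suc (s + t))
  case-nil : ∀ {m} {ρ : Vec Tree m} {e e₀ e₁ v s t} →
             Eval body ρ e nil s → Eval body ρ e₀ v t →
             Eval body ρ (case e e₀ e₁) v (suc (s + t))
  case-∙   : ∀ {m} {ρ : Vec Tree m} {e e₀ e₁ x y v s t} →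
             Eval body ρ e (x ∙ y) s → Eval body (x ∷ y ∷ ρ) e₁ v t →
             Eval body ρ (case e e₀ e₁) v (suc (s + t))
  bind     : ∀ {m} {ρ : Vec Tree m} {e₀ e₁ x v s t} →
             Eval body ρ e₀ x s → Eval body (x ∷ ρ) e₁ v t →
             Eval body ρ (bind e₀ e₁) v (suc (s + t))
  call     : ∀ {m} {ρ : Vec Tree m} {g e x v s t} →
             Eval body ρ e x s → Eval body (x ∷ []) (body g) v t →
             Eval body ρ (call g e) v (suc (s + t))

Eval-deterministic : ∀ {k} {body : Fin k → Exp k 1} {m} {ρ : Vec Tree m} {e v w s t} →
                     Eval body ρ e v s → Eval body ρ e w t → v ≡ w × s ≡ t
Eval-deterministic (var i) (var .i) = refl , refl
Eval-deterministic nil nil = refl , refl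
Eval-deterministic (p ∙ q) (p′ ∙ q′)
  with refl , refl ← Eval-deterministic p p′
     | refl , refl ← Eval-deterministic q q′ = refl , refl
Eval-deterministic (case-nil p q) (case-nil p′ q′)
  with refl , refl ← Eval-deterministic p p′
     | refl , refl ← Eval-deterministic q q′ = refl , refl
Eval-deterministic (case-nil p q) (case-∙ p′ q′)
  with () , _ ← Eval-deterministic p p′
Eval-deterministic (case-∙ p q) (case-nil p′ q′)
  with () , _ ← Eval-deterministic p p′
Eval-deterministic (case-∙ p q) (case-∙ p′ q′)
  with refl , refl ← Eval-deterministic p p′
  with refl , refl ← Eval-deterministic q q′ = refl , refl
Eval-deterministic (bind p q) (bind p′ q′)
  with refl , refl ← Eval-deterministic p p′
  with refl , refl ← Eval-deterministic q q′ = refl , refl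
Eval-deterministic (call p q) (call p′ q′)
  with refl , refl ← Eval-deterministic p p′
  with refl , refl ← Eval-deterministic q q′ = refl , refl

-- `Runs P x y t`: on input x, the program P halts with output y after t steps.
Runs : Program → Tree → Tree → ℕ → Set
Runs P x y t = Eval (Program.body P) (x ∷ []) (Program.main P) y t

encodeList : List Tree → Tree
encodeList []       = nil
encodeList (x ∷ xs) = x ∙ encodeList xs

encodeBool : Bool → Tree
encodeBool false = nil
encodeBool true  = nil ∙ nil

encodeℕ : ℕ → Tree
encodeℕ k = encodeList (replicate k nil)

-- The adjacency matrix, row by row.
encodeGraph : ∀ {n} → Graph (Fin n) → Tree
encodeGraph G = encodeList (tabulate λ i → encodeList (tabulate λ j → encodeBool (Graph.adj G i j)))

-- The characteristic vector.
encodeSubset : ∀ {n} → Subset n → Tree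
encodeSubset X = encodeList (map encodeBool (toList X))

record ParameterizedProblem : Set₁ where
  field
    Instance  : Set
    encode    : Instance → Tree
    parameter : Instance → ℕ
    Answer    : Instance → Tree → Set

-- Π can be solved in O*(g) time, where g is a function of the parameter: a
-- single program answers every instance x correctly within c · |x|ᵈ · g(ℓ)
-- steps, where c and d do not depend on x.
SolvableInO* : ParameterizedProblem → (ℕ → ℕ) → Set
SolvableInO* Π g =
  Σ Program λ P → ∃₂ λ c d → (x : Instance) → ∃₂ λ y t →
    Runs P (encode x) y t × Answer x y ×
    t ≤ c * size (encode x) ^ d * g (parameter x)
  where open ParameterizedProblem Π

-- As usual for parameterized problems, an instance is a graph together with the
-- value ℓ of the parameter.  The chordal deletion in `promise` is not part of
-- the encoding.  As it forces ℓ ≤ n, the unary encoding of ℓ does not affect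
-- which factors are polynomial in the input size.
record ChordalDeletionInstance : Set where
  field
    {n}     : ℕ
    graph   : Graph (Fin n)
    ℓ       : ℕ
    promise : HasChordalDeletionOfSize graph ℓ

  encode : Tree
  encode = encodeGraph graph ∙ encodeℕ ℓ

ChordalDeletion : ParameterizedProblem
ChordalDeletion = record
  { Instance  = ChordalDeletionInstance
  ; encode    = encode
  ; parameter = ℓ
  ; Answer    = λ x y → ∃ λ X → y ≡ encodeSubset X × ∣ X ∣ ≡ ℓ x × IsChordalDeletion (graph x) X
  }
  where open ChordalDeletionInstance

record IndependentCutsetInstance : Set where
  field
    underlying : ChordalDeletionInstance
  open ChordalDeletionInstance underlying public
  field
    connected  : Connected graph

IndependentCutset : ParameterizedProblem
IndependentCutset = record
  { Instance  = IndependentCutsetInstance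
  ; encode    = encode
  ; parameter = ℓ
  ; Answer    = λ x y → ∃ λ b → y ≡ encodeBool b × (b ≡ true ⇔ HasIndependentCutset (graph x))
  }
  where open IndependentCutsetInstance

{-# OPTIONS --safe #-}
module Submission where

-- An independent cutset is the middle class of a labelling of the vertices by
-- left, cut and right in which no edge joins left to right or cut to cut, and
-- both sides are used.  Guess the labels of a chordal deletion in all 3^ℓ ways,
-- and one vertex of each side.  What remains is a binary constraint satisfaction
-- problem on a chordal graph, which enforcing path consistency decides: if the
-- resulting relation is nonempty, then a solution is built by inserting the
-- vertices in the reverse of a perfect elimination ordering.  When v is inserted,
-- its neighbours form a clique; path consistency says that any two of them permit
-- a common label at v, and the labels on a clique are such that then all of them
-- do.  The elimination ordering is needed in this proof only, not in the algorithm.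

open import Algebra.Properties.CommutativeSemigroup using (x∙yz≈y∙xz)
open import Data.Bool using (Bool; true; false; T; if_then_else_; not; _∧_; _∨_)
open import Data.Bool.ListAction using (any; all)
open import Data.Bool.Properties using (T?; T-≡; T-∧; T-∨; ∧-zeroʳ)
open import Data.Empty using (⊥)
open import Data.Fin using (Fin; zero; suc; toℕ; fromℕ; splitAt; _↑ˡ_; _↑ʳ_)
open import Data.Fin.Properties
  using (_≟_; any?; all?; toℕ-injective; toℕ-fromℕ; splitAt-↑ˡ; splitAt-↑ʳ)
open import Data.Fin.Subset using (Subset; _∈_; _∉_; _⊆_; _⊂_; ∁; ∣_∣; _-_; inside; outside)
open import Data.Fin.Subset.Properties
  using (_∈?_; nonempty?; p─q⊆p; p⊂q⇒∣p∣<∣q∣; x∈p⇒p-x⊂p; x∈p⇒∣p-x∣<∣p∣; x∈p∧x≢y⇒x∈p-y; x∉p⇒x∈∁p;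
         x∈∁p⇒x∉p)
import Data.List as List
open import Data.List
  using (List; []; _∷_; _++_; map; foldr; replicate; length; null; filterᵇ; cartesianProduct;
         tabulate; allFin)
open import Data.List.Membership.Propositional using () renaming (_∈_ to _∈ˡ_)
open import Data.List.Membership.Propositional.Properties
  using (∈-lookup; ∈-filter⁺; ∈-filter⁻; ∈-cartesianProduct⁺; ∈-allFin)
open import Data.List.Properties
  using (map-∘; map-cong; map-replicate; map-tabulate; tabulate-cong; length-map; length-tabulate;
         length-filter; filter-complete)
open import Data.List.Relation.Unary.All as All using (All; []; _∷_)
open import Data.List.Relation.Unary.All.Properties using (all⁺; all⁻; ¬Any⇒All¬)
open import Data.List.Relation.Unary.Any as Any using (Any; here; there)
open import Data.List.Relation.Unary.Any.Properties using (any⁺; any⁻)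
open import Data.Nat using (ℕ; zero; suc; _+_; _*_; _^_; _≤_; _<_; z≤n; s≤s; s≤s⁻¹; _≡ᵇ_)
open import Data.Nat.Properties hiding (_≟_)
open import Data.Nat.Solver using (module +-*-Solver)
open import Data.Product using (∃; ∃₂; _×_; _,_; proj₁; proj₂; map₂)
open import Data.Sum using (_⊎_; inj₁; inj₂; [_,_]′)
open import Data.Unit using (⊤; tt)
import Data.Vec as Vec
open import Data.Vec using (Vec; []; _∷_; here; there; lookup; toList)
import Data.Vec.Properties as Vec
open import Data.Vec.Properties.WithK using ([]=-irrelevant)
open import Function using (_∘_; id; _⇔_; mk⇔; Equivalence; case_of_)
open import Relation.Binary.Construct.Closure.ReflexiveTransitive
  using (Star; ε; _◅_; _◅◅_; reverse)
open import Relation.Binary.PropositionalEquality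
  using (_≡_; _≢_; refl; sym; trans; cong; cong₂; subst; subst₂; module ≡-Reasoning)
open import Relation.Nullary
  using (¬_; Dec; yes; no; contradiction; decidable-stable; ¬¬-excluded-middle; _×-dec_; _⊎-dec_;
         _→-dec_; ¬?)
open import Relation.Nullary.Decidable using (map′)
open import Relation.Nullary.Negation using (DoubleNegation; ¬¬-map)
open import Defs

open Equivalence using (to; from)

-- Simplicial vertices of chordal graphs

-- Paths, components and cliques are predicates that are not decided, whereas Dirac's argument and
-- the passage from a cutset to its two sides distinguish cases on them. These arguments are carried
-- out under double negation, which is removed where the goal is decidable: the existence of a
-- simplicial vertex among finitely many, or the value of a Boolean test. That both sides are used
-- is a global condition, not a constraint on pairs of vertices; fixing one vertex on each side
-- expresses it by constraints on single vertices. The time bound concerns an actual program. Each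
-- function of the algorithm is therefore paired with a function table and with polynomials that
-- bound its time and the size of its output. Only the branching stands outside this calculus: its
-- time is not polynomial, and its bound has to keep `3 ^ ℓ` as a separate factor.

infixl 1 _>>=_
_>>=_ : {P Q : Set} → DoubleNegation P → (P → DoubleNegation Q) → DoubleNegation Q
(m >>= f) k = m λ p → f p k

return : {P : Set} → P → DoubleNegation P
return p k = k p

-- A `Subset` is a Boolean vector, so forming one decides membership everywhere; under double
-- negation this is possible one element after the other. Components thereby become sets with a
-- cardinality to do induction on.
comprehension : ∀ {n} (P : Fin n → Set) → DoubleNegation (∃ λ (S : Subset n) → ∀ i → i ∈ S ⇔ P i)
comprehension {zero}  P = return ([] , λ ())
comprehension {suc n} P = do
  S , h ← comprehension (P ∘ suc)
  yes p ← ¬¬-excluded-middle {A = P zero}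
    where no ¬p → return (outside ∷ S , λ where
            zero    → mk⇔ (λ ()) (λ p → contradiction p ¬p)
            (suc i) → mk⇔ (λ { (there m) → Equivalence.to (h i) m }) (there ∘ Equivalence.from (h i)))
  return (inside ∷ S , λ where
    zero    → mk⇔ (λ _ → p) (λ _ → here)
    (suc i) → mk⇔ (λ { (there m) → Equivalence.to (h i) m }) (there ∘ Equivalence.from (h i)))

x∉p-x : ∀ {n} (p : Subset n) {x} → ¬ x ∈ p - x
x∉p-x (inside  ∷ p) {zero} ()
x∉p-x (outside ∷ p) {zero} ()
x∉p-x (b ∷ p) {suc x} (there h) = x∉p-x p h

module _ {n} (G : Graph (Fin n)) where
  open Graph G renaming (sym to adj-sym)

  Near : Fin n → Fin n → Set
  Near x w = x ≡ w ⊎ Adj x w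

  near? : ∀ x w → Dec (Near x w)
  near? x w = (x ≟ w) ⊎-dec T? (adj x w)

  -- x ∷ l is an induced path that ends in y.
  data InducedPath : Fin n → List (Fin n) → Fin n → Set where
    [-]  : ∀ {x} → InducedPath x [] x
    _◃[_]_ : ∀ {x z l y} → Adj x z → All (λ w → ¬ Near x w) l → InducedPath z l y → InducedPath x (z ∷ l) y

  -- In an induced path, `x` can be followed only by the last vertex near it, so the given path is
  -- cut there. If that vertex is `x` itself, the remainder already starts at `x`.
  path-extend : ∀ {Q : Fin n → Set} x {z l y} → InducedPath z l y → All Q (z ∷ l) → Near x z ⊎ Any (Near x) l →
                ∃ λ l′ → InducedPath x l′ y × All Q l′
  path-extend x {l = l} p qs near with Any.any? (near? x) l
  path-extend x (_ ◃[ _ ] p) (_ ∷ qs) near | yes (Any.here h)  = path-extend x p qs (inj₁ h)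
  path-extend x (_ ◃[ _ ] p) (_ ∷ qs) near | yes (Any.there h) = path-extend x p qs (inj₂ h)
  ... | no ¬l with near
  ...   | inj₂ h           = contradiction h ¬l
  ...   | inj₁ (inj₁ refl) = _ , p , All.tail qs
  ...   | inj₁ (inj₂ a)    = _ , (a ◃[ ¬Any⇒All¬ _ ¬l ] p) , qs

  path-consecutive : ∀ {x l y} → InducedPath x l y → ∀ i j → toℕ j ≡ suc (toℕ i) →
                     Adj (List.lookup (x ∷ l) i) (List.lookup (x ∷ l) j)
  path-consecutive (a ◃[ _ ] p) zero    (suc zero) eq = a
  path-consecutive (a ◃[ _ ] p) (suc i) (suc j)    eq = path-consecutive p i j (suc-injective eq)

  path-injective : ∀ {x l y} → InducedPath x l y → ∀ i j → List.lookup (x ∷ l) i ≡ List.lookup (x ∷ l) j → i ≡ j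
  path-head≢ : ∀ {x z l y} → InducedPath x (z ∷ l) y → ∀ j → x ≢ List.lookup (z ∷ l) j

  path-injective [-]         zero    zero    eq = refl
  path-injective (_ ◃[ _ ] _) zero    zero    eq = refl
  path-injective p@(_ ◃[ _ ] _) zero    (suc j) eq = contradiction eq (path-head≢ p j)
  path-injective p@(_ ◃[ _ ] _) (suc i) zero    eq = contradiction (sym eq) (path-head≢ p i)
  path-injective (_ ◃[ _ ] p) (suc i) (suc j) eq = cong suc (path-injective p i j eq)

  path-head≢ (a ◃[ _ ] _)  zero    refl = irrefl _ a
  path-head≢ (_ ◃[ hs ] _) (suc j) eq   = All.lookup hs (∈-lookup j) (inj₁ eq)

  path-adjacent : ∀ {x l y} → InducedPath x l y → ∀ i j → Adj (List.lookup (x ∷ l) i) (List.lookup (x ∷ l) j) →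
                  toℕ j ≡ suc (toℕ i) ⊎ toℕ i ≡ suc (toℕ j)
  path-adjacent [-]          zero          zero          a = contradiction a (irrefl _)
  path-adjacent (_ ◃[ _ ] _)  zero          zero          a = contradiction a (irrefl _)
  path-adjacent (_ ◃[ _ ] _)  zero          (suc zero)    a = inj₁ refl
  path-adjacent (_ ◃[ _ ] _)  (suc zero)    zero          a = inj₂ refl
  path-adjacent (_ ◃[ hs ] _) zero          (suc (suc j)) a = contradiction (inj₂ a) (All.lookup hs (∈-lookup j))
  path-adjacent (_ ◃[ hs ] _) (suc (suc i)) zero          a = contradiction (inj₂ (adj-sym a)) (All.lookup hs (∈-lookup i))
  path-adjacent (_ ◃[ _ ] p)  (suc i)       (suc j)       a with path-adjacent p i j a
  ... | inj₁ eq = inj₁ (cong suc eq)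
  ... | inj₂ eq = inj₂ (cong suc eq)

  path-last : ∀ {x l y} → InducedPath x l y → List.lookup (x ∷ l) (fromℕ (length l)) ≡ y
  path-last [-]         = refl
  path-last (_ ◃[ _ ] p) = path-last p

  path-last-index : ∀ {x l y} → InducedPath x l y → ∀ i → List.lookup (x ∷ l) i ≡ y → toℕ i ≡ length l
  path-last-index {l = l} p i eq =
    trans (cong toℕ (path-injective p i (fromℕ (length l)) (trans eq (sym (path-last p))))) (toℕ-fromℕ _)

  path-last-lookup : ∀ {x l y} → InducedPath x l y → ∀ i → toℕ i ≡ length l → List.lookup (x ∷ l) i ≡ y
  path-last-lookup {x} {l} p i eq =
    trans (cong (List.lookup (x ∷ l)) (toℕ-injective (trans eq (sym (toℕ-fromℕ _))))) (path-last p)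

  Outside : Fin n → Fin n → Set
  Outside s w = s ≢ w × ¬ Adj s w

  module _ (D : Subset n) where

    -- The end `y` is exempt from being far from `s`, and injectivity of the path confines it to the
    -- last place. So `s` is adjacent to the two ends only, and the cycle is a triangle exactly when
    -- `l` is empty.
    close-path : ∀ {s x z l y} → InducedPath x (z ∷ l) y → Adj s x → Adj s y →
                 All (λ w → Outside s w ⊎ w ≡ y) (z ∷ l) → All (_∈ ∁ D) (s ∷ x ∷ z ∷ l) →
                 InducedCycle (G − D) (suc (length (x ∷ z ∷ l)))
    close-path {s} {x} {z} {l} {y} p sx sy far inD = record
      { 3≤k       = s≤s (s≤s (s≤s z≤n))
      ; vertex    = vertex
      ; injective = λ eq → injective _ _ (cong proj₁ eq)
      ; adjacency = λ i j → mk⇔ (adj⇒ i j) (adj⇐ i j)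
      }
      where
      xs = x ∷ z ∷ l

      vertex : Fin (suc (length xs)) → _
      vertex i = List.lookup (s ∷ xs) i , All.lookup inD (∈-lookup i)

      s≢ : ∀ i → s ≢ List.lookup xs i
      s≢ zero    refl = irrefl _ sx
      s≢ (suc i) eq with All.lookup far (∈-lookup i)
      ... | inj₁ (h , _) = h eq
      ... | inj₂ refl    = irrefl _ (subst (Adj s) (sym eq) sy)

      injective : ∀ i j → List.lookup (s ∷ xs) i ≡ List.lookup (s ∷ xs) j → i ≡ j
      injective zero    zero    eq = refl
      injective zero    (suc j) eq = contradiction eq (s≢ j)
      injective (suc i) zero    eq = contradiction (sym eq) (s≢ i)
      injective (suc i) (suc j) eq = cong suc (path-injective p i j eq)

      s-adj : ∀ i → Adj s (List.lookup xs i) → toℕ i ≡ 0 ⊎ toℕ i ≡ suc (length l)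
      s-adj zero    a = inj₁ refl
      s-adj (suc i) a with All.lookup far (∈-lookup i)
      ... | inj₁ (_ , h) = contradiction a h
      ... | inj₂ eq      = inj₂ (path-last-index p (suc i) eq)

      adj-s : ∀ i → toℕ i ≡ suc (length l) → Adj s (List.lookup xs i)
      adj-s i eq = subst (Adj s) (sym (path-last-lookup p i eq)) sy

      Edge : Fin (suc (length xs)) → Fin (suc (length xs)) → Set
      Edge i j = Adj (List.lookup (s ∷ xs) i) (List.lookup (s ∷ xs) j)

      adj⇒ : ∀ i j → Edge i j → Next i j ⊎ Next j i
      adj⇒ zero    zero    a = contradiction a (irrefl _)
      adj⇒ zero    (suc j) a with s-adj j a
      ... | inj₁ eq = inj₁ (inj₁ (cong suc eq))
      ... | inj₂ eq = inj₂ (inj₂ (cong (2 +_) eq , refl))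
      adj⇒ (suc i) zero    a with s-adj i (adj-sym a)
      ... | inj₁ eq = inj₂ (inj₁ (cong suc eq))
      ... | inj₂ eq = inj₁ (inj₂ (cong (2 +_) eq , refl))
      adj⇒ (suc i) (suc j) a with path-adjacent p i j a
      ... | inj₁ eq = inj₁ (inj₁ (cong suc eq))
      ... | inj₂ eq = inj₂ (inj₁ (cong suc eq))

      next⇒ : ∀ i j → Next i j → Edge i j
      next⇒ zero    (suc zero) (inj₁ eq)       = sx
      next⇒ (suc i) (suc j)    (inj₁ eq)       = path-consecutive p i j (suc-injective eq)
      next⇒ (suc i) zero       (inj₂ (eq , _)) = adj-sym (adj-s i (suc-injective (suc-injective eq)))

      adj⇐ : ∀ i j → Next i j ⊎ Next j i → Edge i j
      adj⇐ i j (inj₁ h) = next⇒ i j h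
      adj⇐ i j (inj₂ h) = adj-sym (next⇒ j i h)

  -- Dirac's lemma

  Simplicial : Subset n → Fin n → Set
  Simplicial W v = ∀ x y → x ∈ W → y ∈ W → Adj v x → Adj v y → x ≢ y → Adj x y

  Clique : (Fin n → Set) → Set
  Clique K = ∀ {x y} → K x → K y → x ≢ y → Adj x y

  module Dirac (D : Subset n) (chordal : IsChordalDeletion G D) where

    NewSimplicial : Subset n → (Fin n → Set) → Set
    NewSimplicial W K = ∃ λ v → v ∈ W × ¬ K v × Simplicial W v

    -- Dirac's lemma, strengthened for the induction on W: the simplicial vertex can be
    -- chosen outside any given clique that is not all of W.
    Claim : Subset n → Set₁
    Claim W = W ⊆ ∁ D → (K : Fin n → Set) → (∀ {x} → K x → x ∈ W) → Clique K →
              (∃ λ w → w ∈ W × ¬ K w) → DoubleNegation (NewSimplicial W K)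

    module Component {W : Subset n} (W⊆ : W ⊆ ∁ D) {s} (s∈W : s ∈ W) {t} (t∈W : t ∈ W) (st : Outside s t) where

      Far : Fin n → Set
      Far w = w ∈ W × Outside s w

      Step : Fin n → Fin n → Set
      Step u w = Far u × Far w × Adj u w

      -- This is the component of `t` in `W` without `s` and the neighbours of `s`.
      C : Fin n → Set
      C w = Far w × Star Step t w

      -- C together with its neighbours in W; those outside C are neighbours of s.
      C⁺ : Fin n → Set
      C⁺ w = w ∈ W × (C w ⊎ ∃ λ c → C c × Adj c w)

      boundary : ∀ {w} → C⁺ w → ¬ Adj s w → C w
      boundary (w∈W , inj₁ c)            ¬sw = c
      boundary (w∈W , inj₂ (c , Cc@(far , p) , cw)) ¬sw =
        farʷ , p ◅◅ (far , farʷ , cw) ◅ ε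
        where farʷ = w∈W , (λ { refl → proj₂ (proj₂ far) (adj-sym cw) }) , ¬sw

      ¬C⁺s : ¬ C⁺ s
      ¬C⁺s (_ , inj₁ ((_ , s≢s , _) , _))              = s≢s refl
      ¬C⁺s (_ , inj₂ (_ , ((_ , _ , ¬sc) , _) , cs)) = ¬sc (adj-sym cs)

      Q : Fin n → Fin n → Set
      Q y w = (Outside s w ⊎ w ≡ y) × w ∈ W

      walk : ∀ {y c c′} → Star Step c c′ → ∃ (λ l → InducedPath c′ l y × All (Q y) (c′ ∷ l)) →
             ∃ (λ l → InducedPath c l y × All (Q y) (c ∷ l))
      walk ε                                h = h
      walk (((c∈W , out) , _ , a) ◅ steps)  h with l , p , qs ← walk steps h
        with l′ , p′ , qs′ ← path-extend _ p qs (inj₁ (inj₂ a)) = l′ , p′ , (inj₁ out , c∈W) ∷ qs′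

      -- Two neighbours of `s` in `C⁺` are joined through `C` by an induced path whose inner
      -- vertices are neither `s` nor adjacent to it. Unless this path is a single edge, `s` closes
      -- it to an induced cycle of length at least 4.
      boundary-clique : ∀ {x y} → C⁺ x → C⁺ y → Adj s x → Adj s y → x ≢ y → Adj x y
      boundary-clique {x} {y} (x∈W , hx) (y∈W , hy) sx sy x≢y with hx | hy
      ... | inj₁ ((_ , _ , ¬sx) , _) | _ = contradiction sx ¬sx
      ... | inj₂ _ | inj₁ ((_ , _ , ¬sy) , _) = contradiction sy ¬sy
      ... | inj₂ (c , (_ , tc) , cx) | inj₂ (c′ , ((c′∈W , out′) , tc′) , c′y)
        with l₁ , p₁ , qs₁ ← path-extend c′ [-] ((inj₂ refl , y∈W) ∷ []) (inj₁ (inj₂ c′y))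
        -- The walk runs from `c` back to `t` and on to `c′`.
        with l₂ , p₂ , qs₂ ← walk (reverse (λ (a , b , e) → b , a , adj-sym e) tc ◅◅ tc′)
                               (l₁ , p₁ , (inj₁ out′ , c′∈W) ∷ qs₁)
        with path-extend x p₂ qs₂ (inj₁ (inj₂ (adj-sym cx)))
      ... | [] , [-] , _ = contradiction refl x≢y
      ... | z ∷ [] , (a ◃[ _ ] [-]) , _ = a
      ... | z ∷ z′ ∷ l , p , qs =
        contradiction (chordal (close-path D p sx sy (All.map proj₁ qs)
          (W⊆ s∈W ∷ W⊆ x∈W ∷ All.map (W⊆ ∘ proj₂) qs))) (λ ())

      -- Simplicial vertices of C⁺ that lie in C are simplicial in W.
      new-simplicial : (∀ {W′} → W′ ⊂ W → Claim W′) → DoubleNegation (∃ λ v → v ∈ W × Outside s v × Simplicial W v)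
      new-simplicial claim = do
        W′ , W′⇔ ← comprehension C⁺
        let to   = λ {w} → Equivalence.to (W′⇔ w)
            from = λ {w} → Equivalence.from (W′⇔ w)
        -- The clique to avoid is the set of neighbours of `s` in `C⁺`. A vertex outside it lies in
        -- `C`, so all its neighbours in `W` belong to `C⁺`. The set is smaller than `W` as it
        -- misses `s`, and `t` is outside the clique.
        v , v∈W′ , ¬Kv , simp ← claim {W′} ((proj₁ ∘ to) , s , s∈W , ¬C⁺s ∘ to) (W⊆ ∘ proj₁ ∘ to)
          (λ w → w ∈ W′ × Adj s w) proj₁
          (λ (x∈ , sx) (y∈ , sy) → boundary-clique (to x∈) (to y∈) sx sy)
          (t , from (t∈W , inj₁ ((t∈W , st) , ε)) , λ (_ , a) → proj₂ st a)
        let Cv@((v∈W , out) , _) = boundary (to v∈W′) (λ a → ¬Kv (v∈W′ , a))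
        return (v , v∈W , out , λ x y x∈W y∈W vx vy →
          simp x y (from (x∈W , inj₂ (v , Cv , vx))) (from (y∈W , inj₂ (v , Cv , vy))) vx vy)

    -- The pivot `s` is taken from `K` if possible, so that `K` lies in its closed neighbourhood. If
    -- some vertex of `W` is outside that neighbourhood, the component argument yields a simplicial
    -- vertex not adjacent to `s`, hence not in `K`. Otherwise `s` is adjacent to the rest of `W`,
    -- and simplicial vertices of `W - s` stay simplicial in `W`.
    claim< : ∀ m {W} → ∣ W ∣ < m → Claim W
    claim< (suc m) {W} h W⊆ K K⊆W clique (w , w∈W , ¬Kw) = do
      yes (s , Ks) ← ¬¬-excluded-middle {A = ∃ K}
        where no ¬K → around w w∈W (λ {k} Kk → contradiction (k , Kk) ¬K)
      around s (K⊆W Ks) (λ Kk s≢k → clique Ks Kk s≢k)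
      where
      smaller : ∀ {W′} → W′ ⊂ W → Claim W′
      smaller lt = claim< m (≤-trans (p⊂q⇒∣p∣<∣q∣ lt) (s≤s⁻¹ h))

      around : ∀ s → s ∈ W → (∀ {k} → K k → s ≢ k → Adj s k) → DoubleNegation (NewSimplicial W K)
      around s s∈W pivot = do
        no ¬far ← ¬¬-excluded-middle {A = ∃ λ t → t ∈ W × Outside s t}
          where yes (t , t∈W , out) → do
                  v , v∈W , (s≢v , ¬sv) , simp ← Component.new-simplicial W⊆ s∈W t∈W out smaller
                  return (v , v∈W , (λ Kv → ¬sv (pivot Kv s≢v)) , simp)
        let universal : ∀ {x} → x ∈ W → s ≢ x → Adj s x
            universal x∈W s≢x = decidable-stable (T? _) λ ¬sx → ¬far (_ , x∈W , s≢x , ¬sx)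
        yes (w′ , w′∈W , ¬Kw′ , s≢w′) ← ¬¬-excluded-middle {A = ∃ λ w → w ∈ W × ¬ K w × s ≢ w}
          -- All of `W` except `s` lies in `K`, so the neighbours of `s` form a clique. Also `s` is
          -- not in `K`, as otherwise `w` would be a vertex outside `K` other than `s`.
          where no ¬w → return (s , s∈W
                  , (λ Ks → ¬w (w , w∈W , ¬Kw , λ { refl → ¬Kw Ks }))
                  , λ x y x∈W y∈W sx sy x≢y → decidable-stable (T? _) (do
                      Kx ← (λ ¬Kx → ¬w (x , x∈W , ¬Kx , λ { refl → irrefl _ sx }))
                      Ky ← (λ ¬Ky → ¬w (y , y∈W , ¬Ky , λ { refl → irrefl _ sy }))
                      return (clique Kx Ky x≢y)))
        let keep : ∀ {x} → x ∈ W → s ≢ x → x ∈ W - s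
            keep x∈W s≢x = x∈p∧x≢y⇒x∈p-y x∈W (s≢x ∘ sym)
            -s⊂ = x∈p⇒p-x⊂p s∈W
        v , v∈W′ , ¬Kv , simp ← smaller -s⊂ (W⊆ ∘ proj₁ -s⊂) (λ x → K x × s ≢ x)
          (λ (Kx , s≢x) → keep (K⊆W Kx) s≢x)
          (λ (Kx , _) (Ky , _) → clique Kx Ky) (w′ , keep w′∈W s≢w′ , ¬Kw′ ∘ proj₁)
        let s≢v = λ { refl → x∉p-x W v∈W′ }
        return (v , proj₁ -s⊂ v∈W′ , (λ Kv → ¬Kv (Kv , s≢v)) ,
                λ x y → adjacent (s ≟ x) (s ≟ y) universal keep simp)
        where
        adjacent : ∀ {v x y} → Dec (s ≡ x) → Dec (s ≡ y) →
                   (∀ {x} → x ∈ W → s ≢ x → Adj s x) → (∀ {x} → x ∈ W → s ≢ x → x ∈ W - s) →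
                   Simplicial (W - s) v → x ∈ W → y ∈ W → Adj v x → Adj v y → x ≢ y → Adj x y
        adjacent (yes refl) _          universal keep simp x∈W y∈W vx vy x≢y = universal y∈W x≢y
        adjacent (no _)     (yes refl) universal keep simp x∈W y∈W vx vy x≢y = adj-sym (universal x∈W (x≢y ∘ sym))
        adjacent (no s≢x)   (no s≢y)   universal keep simp x∈W y∈W vx vy x≢y =
          simp _ _ (keep x∈W s≢x) (keep y∈W s≢y) vx vy x≢y

    simplicial-exists : ∀ {W} → W ⊆ ∁ D → ∀ {w} → w ∈ W → DoubleNegation (∃ λ v → v ∈ W × Simplicial W v)
    simplicial-exists {W} W⊆ {w} w∈W = do
      v , v∈W , _ , simp ← claim< (suc ∣ W ∣) (n<1+n _) W⊆ (λ _ → ⊥) (λ ()) (λ ()) (w , w∈W , id)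
      return (v , v∈W , simp)

-- Path consistency

-- A vertex v of the cut S is labelled `cut`; the other two labels are the two sides of G − S.
data Label : Set where
  left cut right : Label

-- Two labels may occur on adjacent vertices if and only if their values do not add up to 2.
value : Label → ℕ
value left  = 0
value cut   = 1
value right = 2

labels : List Label
labels = left ∷ cut ∷ right ∷ []

Literal : ℕ → Set
Literal n = Fin n × Label

-- Equality is tested by `≡ᵇ` on numbers because this is what the programs compute on unary
-- numerals. The first conjunct makes a pair at a single vertex diagonal, from which reflexivity and
-- symmetry of the final relation follow.
compatible : ∀ {n} → Graph (Fin n) → Literal n → Literal n → Bool
compatible G (u , α) (v , β) =
  (not (toℕ u ≡ᵇ toℕ v) ∨ (value α ≡ᵇ value β)) ∧ (not (Graph.adj G u v) ∨ not (value α + value β ≡ᵇ 2))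

same : ∀ {n} → Literal n → Literal n → Bool
same (u , α) (v , β) = (toℕ u ≡ᵇ toℕ v) ∧ (value α ≡ᵇ value β)

member : ∀ {n} → List (Literal n × Literal n) → Literal n → Literal n → Bool
member R p q = any (λ (p′ , q′) → same p p′ ∧ same q q′) R

-- The test of `p` against `F` is how fixed labels act: a literal at a fixed vertex must carry its
-- label, and one at a neighbour must fit it. The last conjunct is the rule of path consistency; `w`
-- also ranges over the vertices of `p` and `q`.
supported : ∀ {n} → Graph (Fin n) → List (Literal n) → List (Literal n × Literal n) → Literal n → Literal n → Bool
supported {n} G F R p q =
  compatible G p q ∧ all (compatible G p) F ∧
  all (λ w → any (λ γ → member R p (w , γ) ∧ member R q (w , γ)) labels) (allFin n)

refine : ∀ {n} → Graph (Fin n) → List (Literal n) → List (Literal n × Literal n) → List (Literal n × Literal n)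
refine G F R = filterᵇ (λ (p , q) → supported G F R p q) R

-- The greatest fixed point of refine is reached after at most length R steps.
refineAll : ∀ {n} → Graph (Fin n) → List (Literal n) → List (Literal n × Literal n) → List (Literal n × Literal n)
refineAll G F R = foldr (λ _ → refine G F) R R

literals : ∀ n → List (Literal n)
literals n = cartesianProduct (allFin n) labels

pathConsistent : ∀ {n} → Graph (Fin n) → List (Literal n) → Bool
pathConsistent {n} G F = not (null (refineAll G F (cartesianProduct (literals n) (literals n))))

separable : ∀ {n} → Graph (Fin n) → List (Literal n) → Bool
separable {n} G F =
  any (λ a → any (λ b → pathConsistent G ((a , left) ∷ (b , right) ∷ F)) (allFin n)) (allFin n)

branch : ∀ {X : Set} → (List (X × Label) → Bool) → List (X × Label) → List X → Bool
branch leaf F []       = leaf F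
branch leaf F (x ∷ xs) =
  branch leaf ((x , left) ∷ F) xs ∨ branch leaf ((x , cut) ∷ F) xs ∨ branch leaf ((x , right) ∷ F) xs

vertices : ∀ {n} → Subset n → List (Fin n)
vertices {n} S = filterᵇ (lookup S) (allFin n)

-- The Boolean tests and the statements that they decide

T-implies : ∀ {b c} → T (not b ∨ c) ⇔ (T b → T c)
T-implies {false}     = mk⇔ (λ _ ()) (λ _ → _)
T-implies {true}  {c} = mk⇔ (λ h _ → h) (λ h → h _)

value-injective : ∀ {α β} → value α ≡ value β → α ≡ β
value-injective {left}  {left}  eq = refl
value-injective {cut}   {cut}   eq = refl
value-injective {right} {right} eq = refl

∈-labels : ∀ α → α ∈ˡ labels
∈-labels left  = here refl
∈-labels cut   = there (here refl)
∈-labels right = there (there (here refl))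

Fits : Label → Label → Set
Fits α β = T (not (value α + value β ≡ᵇ 2))

Fits-sym : ∀ α β → Fits α β → Fits β α
Fits-sym α β = subst (λ k → T (not (k ≡ᵇ 2))) (+-comm (value α) (value β))

filter-shrinks : ∀ {X : Set} (p : X → Bool) l → filterᵇ p l ≡ l ⊎ length (filterᵇ p l) < length l
filter-shrinks p l with m≤n⇒m<n∨m≡n (length-filter (T? ∘ p) l)
... | inj₁ lt = inj₂ lt
... | inj₂ eq = inj₁ (filter-complete (T? ∘ p) eq)

filter-fixed : ∀ {X : Set} (p : X → Bool) {l x} → filterᵇ p l ≡ l → x ∈ˡ l → T (p x)
filter-fixed p {l} eq m = proj₂ (∈-filter⁻ (T? ∘ p) {xs = l} (subst (_ ∈ˡ_) (sym eq) m))

nonempty⁻ : ∀ {X : Set} (l : List X) → T (not (null l)) → ∃ λ x → x ∈ˡ l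
nonempty⁻ (x ∷ _) _ = x , here refl

nonempty⁺ : ∀ {X : Set} {x : X} {l} → x ∈ˡ l → T (not (null l))
nonempty⁺ (here _)  = _
nonempty⁺ (there _) = _

any-Fin⁻ : ∀ {n} (p : Fin n → Bool) → T (any p (allFin n)) → ∃ λ i → T (p i)
any-Fin⁻ p h = Any.satisfied (any⁻ p (allFin _) h)

any-Fin⁺ : ∀ {n} (p : Fin n → Bool) {i} → T (p i) → T (any p (allFin n))
any-Fin⁺ p {i} h = any⁺ p (Any.map (λ { refl → h }) (∈-allFin i))

-- Until a fixed point is reached, each step loses at least one element. After `length l` such steps
-- the list is empty, and `f` cannot shrink it further. Once reached, a fixed point persists.
iterate-fixed : ∀ {X : Set} (f : List X → List X) → (∀ l → f l ≡ l ⊎ length (f l) < length l) →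
                ∀ l → f (foldr (λ _ → f) l l) ≡ foldr (λ _ → f) l l
iterate-fixed {X} f shrinks l = [ id , (λ le → empty _ (n≤0⇒n≡0 (+-cancelˡ-≤ (length l) _ _
    (≤-trans le (≤-reflexive (sym (+-identityʳ _))))))) ]′ (fixed l)
  where
  iterate : List X → List X
  iterate = foldr (λ _ → f) l
  fixed : ∀ k → f (iterate k) ≡ iterate k ⊎ length k + length (iterate k) ≤ length l
  fixed []      = inj₂ ≤-refl
  fixed (_ ∷ k) with fixed k | shrinks (iterate k)
  ... | inj₁ eq | _       = inj₁ (cong f eq)
  ... | inj₂ _  | inj₁ eq = inj₁ (cong f eq)
  ... | inj₂ le | inj₂ lt =
    inj₂ (≤-trans (≤-reflexive (sym (+-suc (length k) _))) (≤-trans (+-monoʳ-≤ (length k) lt) le))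
  empty : ∀ k → length k ≡ 0 → f k ≡ k
  empty [] _ with shrinks []
  ... | inj₁ eq = eq

module _ {n} (G : Graph (Fin n)) where
  open Graph G renaming (sym to adj-sym)

  Compatible : Literal n → Literal n → Set
  Compatible (u , α) (v , β) = (u ≡ v → α ≡ β) × (Adj u v → Fits α β)

  compatible⇔ : ∀ {p q} → T (compatible G p q) ⇔ Compatible p q
  compatible⇔ {u , α} {v , β} = mk⇔
    (λ h → let h₁ , h₂ = to T-∧ h in
      (λ { refl → value-injective (≡ᵇ⇒≡ _ _ (to T-implies h₁ (≡⇒≡ᵇ (toℕ u) _ refl))) }) , to T-implies h₂)
    (λ (h₁ , h₂) → from T-∧
      (from T-implies (λ e → ≡⇒≡ᵇ _ _ (cong value (h₁ (toℕ-injective (≡ᵇ⇒≡ (toℕ u) _ e))))) , from T-implies h₂))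

  same⇔ : ∀ {p q : Literal n} → T (same p q) ⇔ p ≡ q
  same⇔ {u , α} {v , β} = mk⇔
    (λ h → let h₁ , h₂ = to T-∧ h in
      cong₂ _,_ (toℕ-injective (≡ᵇ⇒≡ (toℕ u) _ h₁)) (value-injective (≡ᵇ⇒≡ (value α) _ h₂)))
    (λ { refl → from T-∧ (≡⇒≡ᵇ (toℕ u) _ refl , ≡⇒≡ᵇ (value α) _ refl) })

  Pairs : Set
  Pairs = List (Literal n × Literal n)

  member⇔ : ∀ {R : Pairs} {p q} → T (member R p q) ⇔ (p , q) ∈ˡ R
  member⇔ {R} {p} {q} = mk⇔
    (λ h → Any.map (λ h → let h₁ , h₂ = to T-∧ h in cong₂ _,_ (to same⇔ h₁) (to same⇔ h₂)) (any⁻ _ R h))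
    (λ h → any⁺ (λ (p′ , q′) → same p p′ ∧ same q q′)
      (Any.map (λ { refl → from (T-∧ {same p p}) (from (same⇔ {p}) refl , from (same⇔ {q}) refl) }) h))

  Supported : List (Literal n) → Pairs → Literal n → Literal n → Set
  Supported F R p q = Compatible p q × All (Compatible p) F ×
                      (∀ w → ∃ λ γ → (p , (w , γ)) ∈ˡ R × (q , (w , γ)) ∈ˡ R)

  supported⇔ : ∀ {F R p q} → T (supported G F R p q) ⇔ Supported F R p q
  supported⇔ {F} {R} {p} {q} = mk⇔
    (λ h → let h₁ , h′ = to T-∧ h; h₂ , h₃ = to T-∧ h′ in
      to compatible⇔ h₁ ,
      All.map (to compatible⇔) (all⁺ (compatible G p) F h₂) ,
      (λ w → let γ , h = Any.satisfied (any⁻ (links w) labels (All.lookup (all⁺ linked (allFin n) h₃) (∈-allFin w)))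
                 l , r = to (T-∧ {member R p (w , γ)}) h
             in γ , to member⇔ l , to member⇔ r))
    (λ (h₁ , h₂ , h₃) → from T-∧ (from compatible⇔ h₁ , from T-∧
      ( all⁻ (compatible G p) (All.map (from compatible⇔) h₂)
      , all⁻ linked (All.tabulate {xs = allFin n} λ {w} _ → let γ , l , r = h₃ w in
          any⁺ (links w) (Any.map (λ { refl → from (T-∧ {member R p (w , γ)}) (from member⇔ l , from member⇔ r) })
                            (∈-labels γ))))))
    where
    links : Fin n → Label → Bool
    links w γ = member R p (w , γ) ∧ member R q (w , γ)
    linked : Fin n → Bool
    linked w = any (links w) labels

  refineAll-supported : ∀ F R {p q} → (p , q) ∈ˡ refineAll G F R → Supported F (refineAll G F R) p q
  refineAll-supported F R {p} {q} m = to (supported⇔ {F} {refineAll G F R} {p} {q})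
    (filter-fixed (λ (p , q) → supported G F (refineAll G F R) p q)
      (iterate-fixed (refine G F) (λ R → filter-shrinks (λ (p , q) → supported G F R p q) R) R) m)

  -- Completeness: a solution survives refinement

  Agrees : (Fin n → Label) → List (Literal n) → Set
  Agrees φ F = ∀ {x α} → (x , α) ∈ˡ F → φ x ≡ α

  Valid : (Fin n → Label) → Set
  Valid φ = ∀ {u v} → Adj u v → Fits (φ u) (φ v)

  module _ {φ : Fin n → Label} (valid : Valid φ) where

    -- The pairs read off from a solution support one another: at every `w`, the label `φ w` is
    -- common to all of them.
    refineAll-complete : ∀ {F} → Agrees φ F → ∀ {R} → (∀ u v → ((u , φ u) , (v , φ v)) ∈ˡ R) →
                         ∀ (l : Pairs) u v → ((u , φ u) , (v , φ v)) ∈ˡ foldr (λ _ → refine G F) R l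
    refineAll-complete agrees h []      u v = h u v
    refineAll-complete agrees h (_ ∷ l) u v = ∈-filter⁺ (λ _ → T? _) (ih u v) (from supported⇔
        ( compat
        , All.tabulate (λ f∈F → subst (Compatible (u , φ u)) (cong (_ ,_) (agrees f∈F)) compat)
        , (λ w → φ w , ih u w , ih v w)))
      where
      ih = refineAll-complete agrees h l
      compat : ∀ {u v} → Compatible (u , φ u) (v , φ v)
      compat = cong φ , valid

    pathConsistent-complete : ∀ {F} → Agrees φ F → Fin n → T (pathConsistent G F)
    pathConsistent-complete agrees a = nonempty⁺ (refineAll-complete agrees
        (λ u v → ∈-cartesianProduct⁺ (∈-literals u) (∈-literals v)) (cartesianProduct (literals n) (literals n)) a a)
      where
      ∈-literals : ∀ u → (u , φ u) ∈ˡ literals n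
      ∈-literals u = ∈-cartesianProduct⁺ (∈-allFin u) (∈-labels (φ u))

    separable-complete : ∀ {F a b} → Agrees φ F → φ a ≡ left → φ b ≡ right → T (separable G F)
    separable-complete {F} {a} {b} agrees ha hb =
      any-Fin⁺ (λ a → any (test a) (allFin n)) (any-Fin⁺ (test a) (pathConsistent-complete agrees′ a))
      where
      test : Fin n → Fin n → Bool
      test a b = pathConsistent G ((a , left) ∷ (b , right) ∷ F)
      agrees′ : Agrees φ ((a , left) ∷ (b , right) ∷ F)
      agrees′ (here refl)         = ha
      agrees′ (there (here refl)) = hb
      agrees′ (there (there h))   = agrees h

  branch-complete : ∀ {φ leaf} → (∀ {F} → Agrees φ F → T (leaf F)) → ∀ {F} → Agrees φ F → ∀ xs → T (branch leaf F xs)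
  branch-complete h agrees [] = h agrees
  branch-complete {φ} {leaf} h {F} agrees (x ∷ xs) with φ x in eq
  ... | left  = from T-∨ (inj₁ (branch-complete h (λ { (here refl) → eq ; (there m) → agrees m }) xs))
  ... | cut   = from (T-∨ {branch leaf ((x , left) ∷ F) xs}) (inj₂ (from T-∨ (inj₁
                  (branch-complete h (λ { (here refl) → eq ; (there m) → agrees m }) xs))))
  ... | right = from (T-∨ {branch leaf ((x , left) ∷ F) xs}) (inj₂ (from (T-∨ {branch leaf ((x , cut) ∷ F) xs}) (inj₂
                  (branch-complete h (λ { (here refl) → eq ; (there m) → agrees m }) xs))))

  -- The list at a successful leaf keeps every literal chosen on the way, so it fixes a label at
  -- each vertex branched on. This is the cover that `labelling` asks for.
  branch-sound : ∀ {leaf : List (Literal n) → Bool} F xs → T (branch leaf F xs) →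
                 ∃ λ F′ → T (leaf F′) × (∀ p → p ∈ˡ F → p ∈ˡ F′) × (∀ x → x ∈ˡ xs → ∃ λ α → (x , α) ∈ˡ F′)
  branch-sound {leaf} F []       h = F , h , (λ _ → id) , λ _ ()
  branch-sound {leaf} F (x ∷ xs) h = case choose h of λ (α , h) →
    let F′ , l , F⊆ , cover = branch-sound ((x , α) ∷ F) xs h in
    F′ , l , (λ p → F⊆ p ∘ there) , λ { _ (here refl) → α , F⊆ _ (here refl) ; y (there m) → cover y m }
    where
    choose : T (branch leaf F (x ∷ xs)) → ∃ λ α → T (branch leaf ((x , α) ∷ F) xs)
    choose h with to (T-∨ {branch leaf ((x , left) ∷ F) xs}) h
    ... | inj₁ h = left , h
    ... | inj₂ h with to (T-∨ {branch leaf ((x , cut) ∷ F) xs}) h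
    ...   | inj₁ h = cut , h
    ...   | inj₂ h = right , h

  -- Soundness: a solution from path consistency and chordality

  module Extension (D : Subset n) (chordal : IsChordalDeletion G D) {F : List (Literal n)} {R : Pairs}
                   (closed : ∀ {p q} → (p , q) ∈ˡ R → Supported F R p q)
                   {p₀ q₀} (nonempty : (p₀ , q₀) ∈ˡ R) where

    Rel : Literal n → Literal n → Set
    Rel p q = (p , q) ∈ˡ R

    Rel? : ∀ p q → Dec (Rel p q)
    Rel? p q = map′ (to member⇔) (from member⇔) (T? (member R p q))

    compat : ∀ {p q} → Rel p q → Compatible p q
    compat r = proj₁ (closed r)

    compatF : ∀ {p q f} → Rel p q → f ∈ˡ F → Compatible p f
    compatF r = All.lookup (proj₁ (proj₂ (closed r)))

    common : ∀ {p q} → Rel p q → ∀ w → ∃ λ γ → Rel p (w , γ) × Rel q (w , γ)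
    common r = proj₂ (proj₂ (closed r))

    -- Apply the consistency rule at the vertex of `p` itself: the common label there can only be
    -- that of `p`. `Rel-refl` does the same at the vertex of `q`.
    Rel-sym : ∀ {p q} → Rel p q → Rel q p
    Rel-sym {w , α} {q} r with γ , l , r′ ← common r w =
      subst (λ γ → Rel q (w , γ)) (sym (proj₁ (compat l) refl)) r′

    Rel-refl : ∀ {p q} → Rel p q → Rel q q
    Rel-refl {p} {v , β} r with γ , _ , r′ ← common r v =
      subst (λ γ → Rel (v , β) (v , γ)) (sym (proj₁ (compat r′) refl)) r′

    simplicial? : ∀ W v → Dec (Simplicial G W v)
    simplicial? W v = all? λ x → all? λ y →
      (x ∈? W) →-dec (y ∈? W) →-dec T? (adj v x) →-dec T? (adj v y) →-dec ¬? (x ≟ y) →-dec T? (adj x y)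

    -- The loops carry the information at a vertex without neighbours in `W`, in particular that its
    -- label respects `F`. They also cover the case of two equal neighbours in `pair`.
    Partial : Subset n → (Fin n → Label) → Set
    Partial W φ = (∀ {u v} → u ∈ W → v ∈ W → Adj u v → Rel (u , φ u) (v , φ v)) ×
                  (∀ {u} → u ∈ W → Rel (u , φ u) (u , φ u))

    -- Pairwise intersecting sets of labels have a common element, unless all three
    -- sets of two labels are among them.  The labels permitted at v by the labels of
    -- a clique are never such a family.
    module _ {W φ v} (partial : Partial W φ) (simp : Simplicial G W v) where

      Nbr : Fin n → Set
      Nbr y = y ∈ W × Adj v y

      bad? : ∀ γ → Dec (∃ λ y → Nbr y × ¬ Rel (y , φ y) (v , γ))
      bad? γ = any? λ y → ((y ∈? W) ×-dec T? (adj v y)) ×-dec ¬? (Rel? (y , φ y) (v , γ))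

      good : ∀ {γ} → ¬ (∃ λ y → Nbr y × ¬ Rel (y , φ y) (v , γ)) → ∀ {y} → Nbr y → Rel (y , φ y) (v , γ)
      good ¬bad nbr = decidable-stable (Rel? _ _) λ ¬r → ¬bad (_ , nbr , ¬r)

      pair : ∀ {y z} → Nbr y → Nbr z → Rel (y , φ y) (z , φ z)
      pair {y} {z} (y∈ , vy) (z∈ , vz) with y ≟ z
      ... | yes refl = proj₂ partial y∈
      ... | no y≢z   = proj₁ partial y∈ z∈ (simp y z y∈ z∈ vy vz y≢z)

      fits : ∀ {y γ} → Nbr y → Rel (y , φ y) (v , γ) → Fits (φ y) γ
      fits (_ , vy) r = proj₂ (compat r) (adj-sym vy)

      is-right : ∀ {α} → Fits α right → Fits α cut → α ≡ right
      is-right {right} _ _ = refl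

      is-left : ∀ {α} → Fits α left → Fits α cut → α ≡ left
      is-left {left} _ _ = refl

      helly : ∃ λ γ → ∀ {y} → Nbr y → Rel (y , φ y) (v , γ)
      helly with bad? left | bad? cut | bad? right
      ... | no ¬bad | _ | _ = left , good ¬bad
      ... | yes _ | no ¬bad | _ = cut , good ¬bad
      ... | yes _ | yes _ | no ¬bad = right , good ¬bad
      ... | yes (x , nx , ¬x) | yes (y , ny , ¬y) | yes (z , nz , ¬z) = contradiction (pair nx nz) ¬xz
        where
        -- At `v`, the labels of `x`, `y`, `z` exclude `left`, `cut`, `right` respectively. Any two
        -- of them have a common label there, which must be the one excluded by the third.
        xy : Rel (x , φ x) (v , right)
        xy with common (pair nx ny) v
        ... | left  , l , _ = contradiction l ¬x
        ... | cut   , _ , r = contradiction r ¬y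
        ... | right , l , _ = l
        zy : Rel (z , φ z) (v , left)
        zy with common (pair nz ny) v
        ... | left  , l , _ = l
        ... | cut   , _ , r = contradiction r ¬y
        ... | right , l , _ = contradiction l ¬z
        xz : Rel (x , φ x) (v , cut) × Rel (z , φ z) (v , cut)
        xz with common (pair nx nz) v
        ... | left  , l , _ = contradiction l ¬x
        ... | cut   , l , r = l , r
        ... | right , _ , r = contradiction r ¬z
        -- Only `right` fits both `right` and `cut`, and only `left` fits both `left` and `cut`. So
        -- `x` and `z` lie on opposite sides, although they are equal or adjacent.
        φx : φ x ≡ right
        φx = is-right (fits nx xy) (fits nx (proj₁ xz))
        φz : φ z ≡ left
        φz = is-left (fits nz zy) (fits nz (proj₂ xz))
        ¬xz : ¬ Rel (x , φ x) (z , φ z)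
        ¬xz r with x ≟ z
        ... | yes refl = case trans (sym φx) φz of λ ()
        ... | no x≢z   = subst₂ Fits φx φz
          (proj₂ (compat r) (simp x z (proj₁ nx) (proj₁ nz) (proj₂ nx) (proj₂ nz) x≢z))

      extension : ∃ λ γ → (∀ {y} → Nbr y → Rel (y , φ y) (v , γ)) × Rel (v , γ) (v , γ)
      extension with any? (λ y → (y ∈? W) ×-dec T? (adj v y))
      ... | yes (y , nbr) = let γ , h = helly in γ , h , Rel-refl (h nbr)
      -- Without neighbours any label at `v` that occurs in `R` will do; the consistency rule for
      -- one pair of `R` supplies it.
      ... | no ¬nbr       = let γ , r , _ = common nonempty v in
                            γ , (λ nbr → contradiction (_ , nbr) ¬nbr) , Rel-refl r

    solution : ∀ m W → ∣ W ∣ < m → W ⊆ ∁ D → ∃ (Partial W)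
    solution (suc m) W h W⊆ with nonempty? W
    ... | no empty = (λ _ → cut) , (λ u∈W → contradiction (_ , u∈W) empty) , (λ u∈W → contradiction (_ , u∈W) empty)
    ... | yes (w , w∈W)
      -- Being simplicial is decidable and there are finitely many candidates, so the doubly negated
      -- existence suffices.
      with v , v∈W , simp ← decidable-stable (any? λ v → (v ∈? W) ×-dec simplicial? W v)
                                (Dirac.simplicial-exists G D chordal W⊆ w∈W)
      with φ , partial ← solution m (W - v) (≤-trans (x∈p⇒∣p-x∣<∣p∣ v∈W) (s≤s⁻¹ h)) (W⊆ ∘ p─q⊆p W _)
      with γ , r , rr ← extension {v = v} partial (λ x y x∈ y∈ → simp x y (p─q⊆p W _ x∈) (p─q⊆p W _ y∈)) =
      ψ , edges , loops
      where
      ψ : Fin n → Label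
      ψ u with u ≟ v
      ... | yes _ = γ
      ... | no _  = φ u
      edges : ∀ {u u′} → u ∈ W → u′ ∈ W → Adj u u′ → Rel (u , ψ u) (u′ , ψ u′)
      edges {u} {u′} u∈ u′∈ a with u ≟ v | u′ ≟ v
      ... | yes refl | yes refl = contradiction a (irrefl _)
      ... | yes refl | no u′≢v  = Rel-sym (r (x∈p∧x≢y⇒x∈p-y u′∈ u′≢v , a))
      ... | no u≢v   | yes refl = r (x∈p∧x≢y⇒x∈p-y u∈ u≢v , adj-sym a)
      ... | no u≢v   | no u′≢v  = proj₁ partial (x∈p∧x≢y⇒x∈p-y u∈ u≢v) (x∈p∧x≢y⇒x∈p-y u′∈ u′≢v) a
      loops : ∀ {u} → u ∈ W → Rel (u , ψ u) (u , ψ u)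
      loops {u} u∈ with u ≟ v
      ... | yes refl = rr
      ... | no u≢v   = proj₂ partial (x∈p∧x≢y⇒x∈p-y u∈ u≢v)

    -- Some literal at the vertex of `f` occurs in `R`. Its compatibility with `f` forces it to be
    -- `f`, and it is compatible with `g` as well.
    pairwise : ∀ {f g} → f ∈ˡ F → g ∈ˡ F → Compatible f g
    pairwise {x , α} {g} f∈ g∈ with γ , r , _ ← common nonempty x =
      subst (λ γ → Compatible (x , γ) g) (proj₁ (compatF {x , γ} r′ f∈) refl) (compatF {x , γ} r′ g∈)
      where r′ = Rel-refl {p₀} {x , γ} r

    -- Labels on `D` are those fixed by `F`. Edges within `D` are settled by `pairwise`, and an edge
    -- leaving `D` by the loop at its outer end, whose literal was tested against `F`.
    labelling : (∀ {x} → x ∈ D → ∃ λ α → (x , α) ∈ˡ F) → ∃ λ φ → Valid φ × Agrees φ F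
    labelling cover with φ , edges , loops ← solution _ (∁ D) (n<1+n _) id = ψ , valid , agrees
      where
      ψ : Fin n → Label
      ψ x with x ∈? D
      ... | yes x∈D = proj₁ (cover x∈D)
      ... | no  _   = φ x
      valid : Valid ψ
      valid {u} {v} a with u ∈? D | v ∈? D
      ... | yes u∈D | yes v∈D = proj₂ (pairwise (proj₂ (cover u∈D)) (proj₂ (cover v∈D))) a
      ... | yes u∈D | no  v∉D = Fits-sym (φ v) _ (proj₂ (compatF (loops (x∉p⇒x∈∁p v∉D)) (proj₂ (cover u∈D))) (adj-sym a))
      ... | no  u∉D | yes v∈D = proj₂ (compatF (loops (x∉p⇒x∈∁p u∉D)) (proj₂ (cover v∈D))) a
      ... | no  u∉D | no  v∉D = proj₂ (compat (edges (x∉p⇒x∈∁p u∉D) (x∉p⇒x∈∁p v∉D) a)) a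
      agrees : Agrees ψ F
      agrees {x} f∈ with x ∈? D
      ... | yes x∈D = proj₁ (pairwise (proj₂ (cover x∈D)) f∈) refl
      ... | no  x∉D = proj₁ (compatF (loops (x∉p⇒x∈∁p x∉D)) f∈) refl

  pathConsistent-sound : ∀ {D} → IsChordalDeletion G D → ∀ {F} → (∀ {x} → x ∈ D → ∃ λ α → (x , α) ∈ˡ F) →
                         T (pathConsistent G F) → ∃ λ φ → Valid φ × Agrees φ F
  pathConsistent-sound {D} chordal {F} cover h =
    Extension.labelling D chordal {F} {refineAll G F pairs} (refineAll-supported F pairs)
      (proj₂ (nonempty⁻ (refineAll G F pairs) h)) cover
    where
    pairs : Pairs
    pairs = cartesianProduct (literals n) (literals n)

  -- From a labelling to an independent cutset

  module _ {φ : Fin n → Label} (valid : Valid φ) where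

    isCut : Label → Bool
    isCut cut = inside
    isCut _   = outside

    cutset : Subset n
    cutset = Vec.tabulate (isCut ∘ φ)

    ∈-cutset : ∀ {v} → v ∈ cutset ⇔ φ v ≡ cut
    ∈-cutset {v} = mk⇔
      (λ h → isCut⁻ (trans (sym (Vec.lookup∘tabulate (isCut ∘ φ) v)) (Vec.[]=⇒lookup h)))
      (λ h → Vec.lookup⇒[]= v _ (trans (Vec.lookup∘tabulate (isCut ∘ φ) v) (cong isCut h)))
      where
      isCut⁻ : ∀ {α} → isCut α ≡ inside → α ≡ cut
      isCut⁻ {cut} _ = refl

    independent : IsIndependent G cutset
    independent u∈ v∈ a = subst₂ Fits (to ∈-cutset u∈) (to ∈-cutset v∈) (valid a)

    stay-left : ∀ {u v} → Star (Graph.Adj (G − cutset)) u v → φ (proj₁ u) ≡ left → φ (proj₁ v) ≡ left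
    stay-left ε h = h
    stay-left {u} (_◅_ {j = w , w∉} a steps) h =
      stay-left steps (step (subst (λ α → Fits α (φ w)) h (valid a)) (x∈∁p⇒x∉p w∉ ∘ from ∈-cutset))
      where
      step : ∀ {α} → Fits left α → α ≢ cut → α ≡ left
      step {left} _ _  = refl
      step {cut}  _ ne = contradiction refl ne

    isCutset : ∀ {a b} → φ a ≡ left → φ b ≡ right → IsCutset G cutset
    isCutset {a} {b} ha hb connected =
      case trans (sym hb) (stay-left (connected (a , outside-cutset ha λ ()) (b , outside-cutset hb λ ())) ha) of λ ()
      where
      outside-cutset : ∀ {v α} → φ v ≡ α → α ≢ cut → v ∈ ∁ cutset
      outside-cutset eq ne = x∉p⇒x∈∁p λ m → ne (trans (sym eq) (to ∈-cutset m))

  separable-sound : ∀ {D} → IsChordalDeletion G D → ∀ {F} → (∀ {x} → x ∈ D → ∃ λ α → (x , α) ∈ˡ F) →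
                    T (separable G F) → HasIndependentCutset G
  separable-sound chordal {F} cover h =
    let test = λ a b → pathConsistent G ((a , left) ∷ (b , right) ∷ F)
        a , ha = any-Fin⁻ (λ a → any (test a) (allFin n)) h
        b , hb = any-Fin⁻ (test a) ha
        φ , valid , agrees = pathConsistent-sound chordal {(a , left) ∷ (b , right) ∷ F}
                               (λ x∈ → map₂ (λ m → there (there m)) (cover x∈)) hb
    in cutset {φ} valid , isCutset {φ} valid {a} {b} (agrees (here refl)) (agrees (there (here refl))) ,
       independent {φ} valid

  -- From an independent cutset to a labelling

  module _ {S : Subset n} where

    side : ∀ {v} (C : Subset n) → Dec (v ∈ S) → Dec (v ∈ C) → Label
    side C (yes _) _       = cut
    side C (no _)  (yes _) = left
    side C (no _)  (no _)  = right

    -- The left side is the component of `u` in `G − S`, the right side all the rest, so an edge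
    -- avoiding `S` cannot join the two. The double negation stems from collecting the component
    -- into a set.
    cut-labelling : IsIndependent G S → ∀ {u v : ∃ (_∈ ∁ S)} → ¬ Star (Graph.Adj (G − S)) u v →
                    DoubleNegation (∃ λ φ → Valid φ × φ (proj₁ u) ≡ left × φ (proj₁ v) ≡ right)
    cut-labelling indep {u , u∉} {v , v∉} ¬uv = do
      C , C⇔ ← comprehension (λ w → ∃ λ w∉ → Star (Graph.Adj (G − S)) (u , u∉) (w , w∉))
      return (labelled C C⇔)
      where
      labelled : ∀ C → (∀ w → w ∈ C ⇔ ∃ λ w∉ → Star (Graph.Adj (G − S)) (u , u∉) (w , w∉)) →
                 ∃ λ φ → Valid φ × φ u ≡ left × φ v ≡ right
      labelled C C⇔ = φ , valid , φu , φv
        where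
        φ : Fin n → Label
        φ w = side C (w ∈? S) (w ∈? C)
        grow : ∀ {x y} → Adj x y → y ∉ S → x ∈ C → y ∈ C
        grow a y∉ x∈C = let x∉ , p = to (C⇔ _) x∈C in from (C⇔ _) (x∉p⇒x∈∁p y∉ , p ◅◅ a ◅ ε)
        valid : Valid φ
        valid {x} {y} a with x ∈? S | y ∈? S | x ∈? C | y ∈? C
        ... | yes x∈ | yes y∈ | _ | _         = contradiction a (indep x∈ y∈)
        ... | yes _ | no _  | _     | yes _   = _
        ... | yes _ | no _  | _     | no _    = _
        ... | no _  | yes _ | yes _ | _       = _
        ... | no _  | yes _ | no _  | _       = _
        ... | no _  | no _  | yes _ | yes _   = _
        ... | no _  | no _  | no _  | no _    = _
        ... | no _  | no y∉ | yes x∈C | no y∉C = contradiction (grow a y∉ x∈C) y∉C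
        ... | no x∉ | no _  | no x∉C | yes y∈C = contradiction (grow (adj-sym a) x∉ y∈C) x∉C
        φu : φ u ≡ left
        φu with u ∈? S | u ∈? C
        ... | yes u∈ | _      = contradiction u∈ (x∈∁p⇒x∉p u∉)
        ... | no _   | yes _  = refl
        ... | no _   | no u∉C = contradiction (from (C⇔ u) (u∉ , ε)) u∉C
        φv : φ v ≡ right
        φv with v ∈? S | v ∈? C
        ... | yes v∈ | _      = contradiction v∈ (x∈∁p⇒x∉p v∉)
        ... | no _   | no _   = refl
        ... | no _   | yes v∈C =
          contradiction (subst (λ v∉ → Star _ _ (v , v∉)) ([]=-irrelevant _ _) (proj₂ (to (C⇔ v) v∈C))) ¬uv

    -- Double negation commutes with finite conjunctions; the induction is the one inside
    -- `comprehension`.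
    ¬¬-∀ : {P : Fin n → Set} → (∀ i → DoubleNegation (P i)) → DoubleNegation (∀ i → P i)
    ¬¬-∀ {P} h = do
      C , C⇔ ← comprehension P
      return (λ i → to (C⇔ i) (decidable-stable (i ∈? C) (¬¬-map (from (C⇔ i)) (h i))))

    -- A cutset only denies that all pairs are joined. If no pair were separated, each would be
    -- joined up to double negation, hence all at once since there are finitely many, against the
    -- denial.
    cutset-separates : IsCutset G S → DoubleNegation (∃ λ u → ∃ λ v → ¬ Star (Graph.Adj (G − S)) u v)
    cutset-separates ¬connected none =
      (do paths ← ¬¬-∀ (λ i → ¬¬-∀ (λ j → linked i j))
          return (λ (i , p) (j , q) → paths i j p q)) ¬connected
      where
      linked : ∀ i j → DoubleNegation (∀ p q → Star (Graph.Adj (G − S)) (i , p) (j , q))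
      linked i j with i ∈? ∁ S | j ∈? ∁ S
      ... | no ¬p | _     = return (λ p → contradiction p ¬p)
      ... | yes _ | no ¬q = return (λ p q → contradiction q ¬q)
      ... | yes p | yes q = ¬¬-map
        (λ path p′ q′ → subst (λ p → Star _ (i , p) (j , q′)) ([]=-irrelevant p p′)
                          (subst (λ q → Star _ (i , p) (j , q)) ([]=-irrelevant q q′) path))
        (λ ¬path → none ((i , p) , (j , q) , ¬path))

  branch-separable : ∀ S → IsChordalDeletion G S → branch (separable G) [] (vertices S) ≡ true ⇔ HasIndependentCutset G
  branch-separable S chordal = mk⇔ sound complete
    where
    sound : branch (separable G) [] (vertices S) ≡ true → HasIndependentCutset G
    sound eq with F , h , _ , cover ← branch-sound [] (vertices S) (from T-≡ eq) =
      separable-sound chordal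
        (λ {x} x∈S → cover x (∈-filter⁺ (λ _ → T? _) (∈-allFin x) (from T-≡ (Vec.[]=⇒lookup x∈S)))) h
    complete : HasIndependentCutset G → branch (separable G) [] (vertices S) ≡ true
    -- The goal is the truth of a Boolean, hence stable, so doubly negated witnesses may be used.
    complete (C , isCut , indep) = to T-≡ (decidable-stable (T? _) (do
      u , v , ¬uv ← cutset-separates isCut
      φ , valid , φu , φv ← cut-labelling indep ¬uv
      return (branch-complete {φ = φ} (λ agrees → separable-complete valid agrees φu φv) (λ ()) (vertices S))))

-- Polynomial-time programs

-- Bounds are syntax rather than functions, so that one induction shows all of them monotone and
-- another bounds each by a monomial. `_⊚_` is composition, as needed for the time of composed
-- programs.
data Pol : Set where
  κ           : ℕ → Pol
  X           : Pol
  _⊕_ _⊗_ _⊚_ : Pol → Pol → Pol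

infixr 6 _⊕_
infixr 7 _⊗_
infixr 8 _⊚_

⟦_⟧ : Pol → ℕ → ℕ
⟦ κ c ⟧   n = c
⟦ X ⟧     n = n
⟦ p ⊕ q ⟧ n = ⟦ p ⟧ n + ⟦ q ⟧ n
⟦ p ⊗ q ⟧ n = ⟦ p ⟧ n * ⟦ q ⟧ n
⟦ p ⊚ q ⟧ n = ⟦ p ⟧ (⟦ q ⟧ n)

mono : ∀ p {m n} → m ≤ n → ⟦ p ⟧ m ≤ ⟦ p ⟧ n
mono (κ c)   le = ≤-refl
mono X       le = le
mono (p ⊕ q) le = +-mono-≤ (mono p le) (mono q le)
mono (p ⊗ q) le = *-mono-≤ (mono p le) (mono q le)
mono (p ⊚ q) le = mono p (mono q le)

^-distribʳ-* : ∀ d m n → (m * n) ^ d ≡ m ^ d * n ^ d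
^-distribʳ-* zero    m n = refl
^-distribʳ-* (suc d) m n =
  trans (cong (m * n *_) (^-distribʳ-* d m n)) ([m*n]*[o*p]≡[m*o]*[n*p] m n (m ^ d) (n ^ d))

module _ where
  open ≤-Reasoning

  -- At 0 a monomial of positive degree vanishes, hence the argument `suc n`; the size of a tree is
  -- always of this form.
  monomial-bound : ∀ p → ∃₂ λ c d → ∀ n → ⟦ p ⟧ (suc n) ≤ c * suc n ^ d
  monomial-bound (κ c) = c , 0 , λ n → ≤-reflexive (sym (*-identityʳ c))
  monomial-bound X     = 1 , 1 , λ n → ≤-reflexive (sym (trans (*-identityˡ _) (*-identityʳ _)))
  monomial-bound (p ⊕ q) with c , d , hp ← monomial-bound p | c′ , d′ , hq ← monomial-bound q =
    c + c′ , d + d′ , λ n → begin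
      ⟦ p ⟧ (suc n) + ⟦ q ⟧ (suc n)                 ≤⟨ +-mono-≤ (hp n) (hq n) ⟩
      c * suc n ^ d + c′ * suc n ^ d′
        ≤⟨ +-mono-≤ (*-monoʳ-≤ c (^-monoʳ-≤ (suc n) (m≤m+n d d′)))
                    (*-monoʳ-≤ c′ (^-monoʳ-≤ (suc n) (m≤n+m d′ d))) ⟩
      c * suc n ^ (d + d′) + c′ * suc n ^ (d + d′)  ≡⟨ *-distribʳ-+ (suc n ^ (d + d′)) c c′ ⟨
      (c + c′) * suc n ^ (d + d′)                   ∎
  monomial-bound (p ⊗ q) with c , d , hp ← monomial-bound p | c′ , d′ , hq ← monomial-bound q =
    c * c′ , d + d′ , λ n → begin
      ⟦ p ⟧ (suc n) * ⟦ q ⟧ (suc n)          ≤⟨ *-mono-≤ (hp n) (hq n) ⟩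
      (c * suc n ^ d) * (c′ * suc n ^ d′)    ≡⟨ [m*n]*[o*p]≡[m*o]*[n*p] c (suc n ^ d) c′ (suc n ^ d′) ⟩
      (c * c′) * (suc n ^ d * suc n ^ d′)    ≡⟨ cong (c * c′ *_) (^-distribˡ-+-* (suc n) d d′) ⟨
      (c * c′) * suc n ^ (d + d′)            ∎
  monomial-bound (p ⊚ q) with c , d , hp ← monomial-bound p | c′ , d′ , hq ← monomial-bound q =
    c * suc c′ ^ d , d′ * d , λ n → let s = suc n in begin
      -- The bound for `p` is available at successors only, and `⟦ q ⟧ s` may be 0.
      ⟦ p ⟧ (⟦ q ⟧ s)               ≤⟨ mono p (n≤1+n _) ⟩
      ⟦ p ⟧ (suc (⟦ q ⟧ s))         ≤⟨ hp (⟦ q ⟧ s) ⟩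
      c * suc (⟦ q ⟧ s) ^ d         ≤⟨ *-monoʳ-≤ c (^-monoˡ-≤ d (s≤s (hq n))) ⟩
      c * suc (c′ * s ^ d′) ^ d     ≤⟨ *-monoʳ-≤ c (^-monoˡ-≤ d (+-monoˡ-≤ (c′ * s ^ d′) (m^n>0 s d′))) ⟩
      c * (suc c′ * s ^ d′) ^ d     ≡⟨ cong (c *_) (^-distribʳ-* d (suc c′) (s ^ d′)) ⟩
      c * (suc c′ ^ d * (s ^ d′) ^ d) ≡⟨ *-assoc c _ _ ⟨
      c * suc c′ ^ d * (s ^ d′) ^ d ≡⟨ cong (c * suc c′ ^ d *_) (^-*-assoc s d′ d) ⟩
      c * suc c′ ^ d * s ^ (d′ * d) ∎

-- Linking of function tables

Table : ℕ → Set
Table k = Fin k → Exp k 1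

rename : ∀ {k l m} → (Fin k → Fin l) → Exp k m → Exp l m
rename r (var i)        = var i
rename r nil            = nil
rename r (e ∙ e₁)       = rename r e ∙ rename r e₁
rename r (case e e₀ e₁) = case (rename r e) (rename r e₀) (rename r e₁)
rename r (bind e e₁)    = bind (rename r e) (rename r e₁)
rename r (call g e)     = call (r g) (rename r e)

Embeds : ∀ {k l} → Table k → Table l → (Fin k → Fin l) → Set
Embeds b c r = ∀ g → c (r g) ≡ rename r (b g)

Eval-rename : ∀ {k l} {b : Table k} {c : Table l} {r} → Embeds b c r →
              ∀ {m} {ρ : Vec Tree m} {e v t} → Eval b ρ e v t → Eval c ρ (rename r e) v t
Eval-rename em (var i)        = var i
Eval-rename em nil            = nil
Eval-rename em (p ∙ q)        = Eval-rename em p ∙ Eval-rename em q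
Eval-rename em (case-nil p q) = case-nil (Eval-rename em p) (Eval-rename em q)
Eval-rename em (case-∙ p q)   = case-∙ (Eval-rename em p) (Eval-rename em q)
Eval-rename em (bind p q)     = bind (Eval-rename em p) (Eval-rename em q)
Eval-rename {c = c} em (call {g = g} p q) =
  call (Eval-rename em p) (subst (λ e → Eval c _ e _ _) (sym (em g)) (Eval-rename em q))

-- The disjoint union of two tables, with one new function at index 0 whose body may call either
-- table and itself. Renaming preserves the number of steps exactly.
link : ∀ {k l} → Table k → Table l → Exp (suc (k + l)) 1 → Table (suc (k + l))
link         b c e zero    = e
link {k} {l} b c e (suc i) =
  [ (λ j → rename (λ h → suc (h ↑ˡ l)) (b j)) , (λ j → rename (λ h → suc (k ↑ʳ h)) (c j)) ]′ (splitAt k i)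

link-embedsˡ : ∀ {k l} (b : Table k) (c : Table l) e → Embeds b (link b c e) (λ h → suc (h ↑ˡ l))
link-embedsˡ {k} {l} b c e g rewrite splitAt-↑ˡ k g l = refl

link-embedsʳ : ∀ {k l} (b : Table k) (c : Table l) e → Embeds c (link b c e) (λ h → suc (k ↑ʳ h))
link-embedsʳ {k} {l} b c e g rewrite splitAt-↑ʳ k l g = refl

Eval≤ : ∀ {k} → Table k → ∀ {m} → Vec Tree m → Exp k m → Tree → ℕ → Set
Eval≤ b ρ e v s = ∃ λ t → Eval b ρ e v t × t ≤ s

module _ {k} {b : Table k} where

  weaken : ∀ {m} {ρ : Vec Tree m} {e v s t} → s ≤ t → Eval≤ b ρ e v s → Eval≤ b ρ e v t
  weaken le (u , p , h) = u , p , ≤-trans h le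

  var≤ : ∀ {m} {ρ : Vec Tree m} i → Eval≤ b ρ (var i) (lookup ρ i) 1
  var≤ i = 1 , var i , ≤-refl

  nil≤ : ∀ {m} {ρ : Vec Tree m} → Eval≤ b ρ nil nil 1
  nil≤ = 1 , nil , ≤-refl

  _∙≤_ : ∀ {m} {ρ : Vec Tree m} {e₀ e₁ x y s t} →
         Eval≤ b ρ e₀ x s → Eval≤ b ρ e₁ y t → Eval≤ b ρ (e₀ ∙ e₁) (x ∙ y) (suc (s + t))
  (_ , p , h) ∙≤ (_ , q , h′) = _ , p ∙ q , s≤s (+-mono-≤ h h′)

  case-nil≤ : ∀ {m} {ρ : Vec Tree m} {e e₀ e₁ v s t} →
              Eval≤ b ρ e nil s → Eval≤ b ρ e₀ v t → Eval≤ b ρ (case e e₀ e₁) v (suc (s + t))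
  case-nil≤ (_ , p , h) (_ , q , h′) = _ , case-nil p q , s≤s (+-mono-≤ h h′)

  case-∙≤ : ∀ {m} {ρ : Vec Tree m} {e e₀ e₁ x y v s t} →
            Eval≤ b ρ e (x ∙ y) s → Eval≤ b (x ∷ y ∷ ρ) e₁ v t →
            Eval≤ b ρ (case e e₀ e₁) v (suc (s + t))
  case-∙≤ (_ , p , h) (_ , q , h′) = _ , case-∙ p q , s≤s (+-mono-≤ h h′)

  call≤ : ∀ {m} {ρ : Vec Tree m} {g e x v s t} →
          Eval≤ b ρ e x s → Eval≤ b (x ∷ []) (b g) v t → Eval≤ b ρ (call g e) v (suc (s + t))
  call≤ (_ , p , h) (_ , q , h′) = _ , call p q , s≤s (+-mono-≤ h h′)

quoted : ∀ {k m} → Tree → Exp k m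
quoted nil     = nil
quoted (x ∙ y) = quoted x ∙ quoted y

quoted≤ : ∀ {k} {b : Table k} {m} {ρ : Vec Tree m} x → Eval≤ b ρ (quoted x) x (size x)
quoted≤ nil     = nil≤
quoted≤ (x ∙ y) = quoted≤ x ∙≤ quoted≤ y

-- Encoded types and polynomial-time functions

infixr 4 _×ᵉ_

-- Encoded data types may depend on a number, which is the order of the graph
-- for vertices and adjacency matrices.
record Enc : Set₁ where
  field
    Car : ℕ → Set
    enc : ∀ {n} → Car n → Tree

  sz : ∀ {n} → Car n → ℕ
  sz a = size (enc a)

open Enc

_×ᵉ_ : Enc → Enc → Enc
A ×ᵉ B = record { Car = λ n → Car A n × Car B n ; enc = λ (a , b) → enc A a ∙ enc B b }

Listᵉ : Enc → Enc
Listᵉ A = record { Car = λ n → List (Car A n) ; enc = λ l → encodeList (map (enc A) l) }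

Boolᵉ ⊤ᵉ ℕᵉ : Enc
Boolᵉ = record { Car = λ _ → Bool ; enc = encodeBool }
⊤ᵉ    = record { Car = λ _ → ⊤ ; enc = λ _ → nil }
ℕᵉ    = record { Car = λ _ → ℕ ; enc = encodeℕ }

Fun : Enc → Enc → Set
Fun A B = ∀ n → Car A n → Car B n

-- The table is chosen before `n`, so one program serves graphs of every order.
record PT (A B : Enc) (f : Fun A B) : Set where
  field
    {k}   : ℕ
    table : Table k
    entry : Fin k
    time  : Pol
    run   : ∀ {n} (a : Car A n) →
            Eval≤ table (enc A a ∷ []) (table entry) (enc B (f n a)) (⟦ time ⟧ (sz A a))
    -- As trees are shared, a bound on the time does not imply one on the size of the output.
    out   : Pol
    out≤  : ∀ {n} (a : Car A n) → sz B (f n a) ≤ ⟦ out ⟧ (sz A a)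

open PT

-- A program sees only trees. It therefore also computes any function between other types whose
-- encodings are the same trees, for example on numbers viewed as lists of units.
recode : ∀ {A B A′ B′} {f : Fun A B} {g : Fun A′ B′} (h : ∀ n → Car A′ n → Car A n) →
         (∀ n a → enc A′ a ≡ enc A (h n a)) → (∀ n a → enc B′ (g n a) ≡ enc B (f n (h n a))) →
         PT A B f → PT A′ B′ g
recode h hA hB F .k     = k F
recode h hA hB F .table = table F
recode h hA hB F .entry = entry F
recode h hA hB F .time  = time F
recode h hA hB F .out   = out F
recode h hA hB F .run {n} a rewrite hA n a | hB n a = run F (h n a)
recode h hA hB F .out≤ {n} a rewrite hA n a | hB n a = out≤ F (h n a)

ext : ∀ {A B} {f g : Fun A B} → (∀ n a → g n a ≡ f n a) → PT A B f → PT A B g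
ext {B = B} eq = recode (λ _ a → a) (λ _ _ → refl) (λ n a → cong (enc B) (eq n a))

module _ {k l} {b : Table k} {c : Table l} {e₀ : Exp (suc (k + l)) 1} where

  callˡ : ∀ {m} {ρ : Vec Tree m} {g e x v s t} → Eval≤ (link b c e₀) ρ e x s →
          Eval≤ b (x ∷ []) (b g) v t → Eval≤ (link b c e₀) ρ (call (suc (g ↑ˡ l)) e) v (suc (s + t))
  callˡ {g = g} p (_ , q , h) =
    call≤ p (_ , subst (λ e → Eval _ _ e _ _) (sym (em g)) (Eval-rename em q) , h)
    where em = link-embedsˡ b c e₀

  callʳ : ∀ {m} {ρ : Vec Tree m} {g e x v s t} → Eval≤ (link b c e₀) ρ e x s →
          Eval≤ c (x ∷ []) (c g) v t → Eval≤ (link b c e₀) ρ (call (suc (k ↑ʳ g)) e) v (suc (s + t))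
  callʳ {g = g} p (_ , q , h) =
    call≤ p (_ , subst (λ e → Eval _ _ e _ _) (sym (em g)) (Eval-rename em q) , h)
    where em = link-embedsʳ b c e₀

idᵖ : ∀ {A} → PT A A (λ _ a → a)
idᵖ .k      = 1
idᵖ .table  = λ _ → var zero
idᵖ .entry  = zero
idᵖ .time   = κ 1
idᵖ .run a  = var≤ zero
idᵖ .out    = X
idᵖ .out≤ a = ≤-refl

constᵖ : ∀ {A B} (x : Tree) {b : ∀ n → Car B n} → (∀ n → enc B (b n) ≡ x) → PT A B (λ n _ → b n)
constᵖ x eq .k      = 1
constᵖ x eq .table  = λ _ → quoted x
constᵖ x eq .entry  = zero
constᵖ x eq .time   = κ (size x)
constᵖ x eq .run {n} a rewrite eq n = quoted≤ x
constᵖ x eq .out    = κ (size x)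
constᵖ x eq .out≤ {n} a rewrite eq n = ≤-refl

fstᵖ : ∀ {A B} → PT (A ×ᵉ B) A (λ _ → proj₁)
fstᵖ .k      = 1
fstᵖ .table  = λ _ → case (var zero) nil (var zero)
fstᵖ .entry  = zero
fstᵖ .time   = κ 3
fstᵖ .run a  = case-∙≤ (var≤ zero) (var≤ zero)
fstᵖ .out    = X
fstᵖ {A} {B} .out≤ (a , b) = m≤n⇒m≤1+n (m≤m+n (sz A a) (sz B b))

sndᵖ : ∀ {A B} → PT (A ×ᵉ B) B (λ _ → proj₂)
sndᵖ .k      = 1
sndᵖ .table  = λ _ → case (var zero) nil (var (suc zero))
sndᵖ .entry  = zero
sndᵖ .time   = κ 3
sndᵖ .run a  = case-∙≤ (var≤ zero) (var≤ (suc zero))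
sndᵖ .out    = X
sndᵖ {A} {B} .out≤ (a , b) = m≤n⇒m≤1+n (m≤n+m (sz B b) (sz A a))

infixr 9 _∘ᵖ_
_∘ᵖ_ : ∀ {A B C} {g : Fun B C} {f : Fun A B} → PT B C g → PT A B f → PT A C (λ n a → g n (f n a))
(G ∘ᵖ F) .k     = suc (k G + k F)
(G ∘ᵖ F) .table = link (table G) (table F)
  (call (suc (entry G ↑ˡ k F)) (call (suc (k G ↑ʳ entry F)) (var zero)))
(G ∘ᵖ F) .entry = zero
(G ∘ᵖ F) .time  = κ 1 ⊕ (κ 2 ⊕ time F) ⊕ (time G ⊚ out F)
(G ∘ᵖ F) .run a = callˡ (callʳ (var≤ zero) (run F a)) (weaken (mono (time G) (out≤ F a)) (run G _))
(G ∘ᵖ F) .out   = out G ⊚ out F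
(G ∘ᵖ F) .out≤ a = ≤-trans (out≤ G _) (mono (out G) (out≤ F a))

infixr 4 _,ᵖ_
_,ᵖ_ : ∀ {A B C} {f : Fun A B} {g : Fun A C} → PT A B f → PT A C g → PT A (B ×ᵉ C) (λ n a → f n a , g n a)
(F ,ᵖ G) .k     = suc (k F + k G)
(F ,ᵖ G) .table = link (table F) (table G)
  (call (suc (entry F ↑ˡ k G)) (var zero) ∙ call (suc (k F ↑ʳ entry G)) (var zero))
(F ,ᵖ G) .entry = zero
(F ,ᵖ G) .time  = κ 1 ⊕ (κ 2 ⊕ time F) ⊕ (κ 2 ⊕ time G)
(F ,ᵖ G) .run a = callˡ (var≤ zero) (run F a) ∙≤ callʳ (var≤ zero) (run G a)
(F ,ᵖ G) .out   = κ 1 ⊕ out F ⊕ out G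
(F ,ᵖ G) .out≤ a = s≤s (+-mono-≤ (out≤ F a) (out≤ G a))

caseList : ∀ {X Y : Set} → List X → Y → (X → List X → Y) → Y
caseList []       y f = y
caseList (x ∷ xs) y f = f x xs

caseᵖ : ∀ {A E B} {f : Fun A B} {g : Fun (A ×ᵉ E ×ᵉ Listᵉ E) B} →
        PT A B f → PT (A ×ᵉ E ×ᵉ Listᵉ E) B g →
        PT (A ×ᵉ Listᵉ E) B (λ n (a , l) → caseList l (f n a) (λ e es → g n (a , e , es)))
caseᵖ F G .k     = suc (k F + k G)
caseᵖ F G .table = link (table F) (table G)
  (case (var zero) nil
    (case (var (suc zero))
      (call (suc (entry F ↑ˡ k G)) (var zero))
      (call (suc (k F ↑ʳ entry G)) (var (suc (suc zero)) ∙ (var zero ∙ var (suc zero))))))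
caseᵖ F G .entry = zero
-- Besides running `F` or `G`, the two branches take 6 and 10 steps; 14 exceeds both.
caseᵖ F G .time  = κ 14 ⊕ time F ⊕ time G ⊚ (κ 2 ⊕ X)
caseᵖ {A} {E} F G .run (a , []) =
  weaken (+-mono-≤ (m≤m+n 6 8)
           (≤-trans (mono (time F) (m≤n⇒m≤1+n (m≤m+n _ _))) (m≤m+n _ _)))
         (case-∙≤ (var≤ zero) (case-nil≤ (var≤ (suc zero)) (callˡ (var≤ zero) (run F a))))
caseᵖ {A} {E} F G .run (a , e ∷ es) =
  weaken (+-mono-≤ (m≤m+n 10 4)
           (≤-trans (mono (time G) (≤-trans (n≤1+n _) (n≤1+n _)))
             (m≤n+m _ (⟦ time F ⟧ (sz (A ×ᵉ Listᵉ E) (a , e ∷ es))))))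
         (case-∙≤ (var≤ zero) (case-∙≤ (var≤ (suc zero)) (callʳ (var≤ _ ∙≤ (var≤ _ ∙≤ var≤ _)) (run G _))))
caseᵖ F G .out = out F ⊕ out G ⊚ (κ 2 ⊕ X)
caseᵖ F G .out≤ (a , []) =
  ≤-trans (out≤ F a) (≤-trans (mono (out F) (m≤n⇒m≤1+n (m≤m+n _ _))) (m≤m+n _ _))
caseᵖ {A} {E} F G .out≤ (a , e ∷ es) =
  ≤-trans (out≤ G _) (≤-trans (mono (out G) (≤-trans (n≤1+n _) (n≤1+n _)))
    (m≤n+m _ (⟦ out F ⟧ (sz (A ×ᵉ Listᵉ E) (a , e ∷ es)))))

foldᵉ : ∀ {A E B} → Fun A B → Fun (A ×ᵉ E ×ᵉ B) B → Fun (A ×ᵉ Listᵉ E) B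
foldᵉ f g n (a , l) = foldr (λ e acc → g n (a , e , acc)) (f n a) l

length≤size : ∀ {A n} (l : List (Car A n)) → length l ≤ sz (Listᵉ A) l
length≤size         []      = z≤n
length≤size {A} (x ∷ l) = s≤s (≤-trans (length≤size {A} l) (m≤n+m _ (sz A x)))

-- Iterating a polynomial-time step may square the size in every round, so a polynomial bound `p` on
-- the result has to be supplied. It bounds all accumulators too, since each is the fold over a tail
-- of the list.
foldᵖ : ∀ {A E B} {f : Fun A B} {g : Fun (A ×ᵉ E ×ᵉ B) B} → PT A B f → PT (A ×ᵉ E ×ᵉ B) B g →
        (p : Pol) → (∀ n a → sz B (foldᵉ {A} {E} {B} f g n a) ≤ ⟦ p ⟧ (sz (A ×ᵉ Listᵉ E) a)) →
        PT (A ×ᵉ Listᵉ E) B (foldᵉ {A} {E} {B} f g)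
foldᵖ {A} {E} {B} {f} {g} F G p h = λ where
    .k          → suc (k F + k G)
    .table      → tab
    .entry      → zero
    .time       → X ⊗ cost
    .run (a , l) → weaken (*-monoˡ-≤ (⟦ cost ⟧ _) (s≤s (≤-trans (length≤size {E} l) (m≤n+m _ (sz A a)))))
                          (steps _ a l ≤-refl)
    .out        → p
    .out≤       → h _
  where
  rec = call zero (var (suc (suc zero)) ∙ var (suc zero))
  tab = link (table F) (table G)
    (case (var zero) nil
      (case (var (suc zero))
        (call (suc (entry F ↑ˡ k G)) (var zero))
        (call (suc (k F ↑ʳ entry G)) (var (suc (suc zero)) ∙ (var zero ∙ rec)))))
  -- The cost of one round: 13 steps besides `G`, or 6 besides `F` at the end of the list. The
  -- argument of `G` consists of context, element and accumulator, with two pair nodes.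
  cost = κ 14 ⊕ time F ⊕ time G ⊚ (κ 2 ⊕ X ⊕ p)

  steps : ∀ s {n} (a : Car A n) l → sz (A ×ᵉ Listᵉ E) (a , l) ≤ s →
          Eval≤ tab (enc (A ×ᵉ Listᵉ E) (a , l) ∷ []) (tab zero)
                (enc B (foldᵉ {A} {E} {B} f g n (a , l))) (suc (length l) * ⟦ cost ⟧ s)
  steps s a [] le =
    weaken (≤-trans (+-mono-≤ (m≤m+n 6 8)
             (≤-trans (mono (time F) (≤-trans (m≤n⇒m≤1+n (m≤m+n _ _)) le)) (m≤m+n _ _))) (m≤m+n _ _))
           (case-∙≤ (var≤ zero) (case-nil≤ (var≤ (suc zero)) (callˡ (var≤ zero) (run F a))))
  steps s {n} a (e ∷ l) le =
    weaken (begin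
              13 + (R + ⟦ time G ⟧ u)                       ≡⟨ cong (13 +_) (+-comm R _) ⟩
              13 + (⟦ time G ⟧ u + R)                       ≡⟨ +-assoc 13 _ R ⟨
              13 + ⟦ time G ⟧ u + R                         ≤⟨ +-monoˡ-≤ R (+-mono-≤ (m≤m+n 13 1)
                  (≤-trans (mono (time G) u≤) (m≤n+m _ (⟦ time F ⟧ s)))) ⟩
              ⟦ cost ⟧ s + R                                ∎)
           (case-∙≤ (var≤ zero) (case-∙≤ (var≤ (suc zero))
             (callʳ (var≤ _ ∙≤ (var≤ _ ∙≤ call≤ (var≤ _ ∙≤ var≤ _) (steps s a l al≤))) (run G _))))
    where
    open ≤-Reasoning
    R = suc (length l) * ⟦ cost ⟧ s
    al≤ : sz (A ×ᵉ Listᵉ E) (a , l) ≤ s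
    al≤ = ≤-trans (s≤s (+-monoʳ-≤ (sz A a) (m≤n⇒m≤1+n (m≤n+m _ (sz E e))))) le
    u = sz (A ×ᵉ E ×ᵉ B) (a , e , foldᵉ {A} {E} {B} f g n (a , l))
    u≤ : u ≤ 2 + (s + ⟦ p ⟧ s)
    u≤ = begin
      suc (sz A a + suc (sz E e + _))  ≡⟨ cong suc (+-suc (sz A a) _) ⟩
      2 + (sz A a + (sz E e + _))      ≡⟨ cong (2 +_) (+-assoc (sz A a) (sz E e) _) ⟨
      2 + (sz A a + sz E e + _)        ≤⟨ +-monoʳ-≤ 2 (+-mono-≤ ae≤ (≤-trans (h n (a , l)) (mono p al≤))) ⟩
      2 + (s + ⟦ p ⟧ s)                ∎
      where
      ae≤ : sz A a + sz E e ≤ s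
      ae≤ = ≤-trans (≤-trans (+-monoʳ-≤ (sz A a) (≤-trans (m≤m+n (sz E e) _) (n≤1+n _))) (n≤1+n _)) le

-- Booleans, lists and unary numerals

bit : Bool → List ⊤
bit false = []
bit true  = tt ∷ []

-- The trees of `false` and `true` are those of `[]` and `tt ∷ []`, so a conditional is a case
-- distinction on a list.
ifᵖ : ∀ {A B b} {f g : Fun A B} → PT A Boolᵉ b → PT A B f → PT A B g →
      PT A B (λ n a → if b n a then f n a else g n a)
ifᵖ {b = b} {f} {g} P F G =
  ext (λ n a → lemma (b n a)) (caseᵖ G (F ∘ᵖ fstᵖ) ∘ᵖ
    (idᵖ ,ᵖ recode (λ _ a → a) (λ _ _ → refl) (λ n a → bit-enc (b n a)) P))
  where
  bit-enc : ∀ c → enc (Listᵉ ⊤ᵉ) {0} (bit c) ≡ encodeBool c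
  bit-enc false = refl
  bit-enc true  = refl
  lemma : ∀ {Y : Set} {y z : Y} c → (if c then y else z) ≡ caseList (bit c) z (λ _ _ → y)
  lemma false = refl
  lemma true  = refl

trueᵖ : ∀ {A} → PT A Boolᵉ (λ _ _ → true)
trueᵖ = constᵖ (encodeBool true) (λ _ → refl)

falseᵖ : ∀ {A} → PT A Boolᵉ (λ _ _ → false)
falseᵖ = constᵖ (encodeBool false) (λ _ → refl)

notᵖ : ∀ {A} {p : Fun A Boolᵉ} → PT A Boolᵉ p → PT A Boolᵉ (λ n a → not (p n a))
notᵖ {p = p} P = ext (λ n a → lemma (p n a)) (ifᵖ P falseᵖ trueᵖ)
  where
  lemma : ∀ c → not c ≡ (if c then false else true)
  lemma false = refl
  lemma true  = refl

module _ {A} {p q : Fun A Boolᵉ} where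

  infixr 6 _∧ᵖ_
  infixr 5 _∨ᵖ_

  _∧ᵖ_ : PT A Boolᵉ p → PT A Boolᵉ q → PT A Boolᵉ (λ n a → p n a ∧ q n a)
  P ∧ᵖ Q = ext (λ n a → lemma (p n a)) (ifᵖ P Q falseᵖ)
    where
    lemma : ∀ c {d} → c ∧ d ≡ (if c then d else false)
    lemma false = refl
    lemma true  = refl

  _∨ᵖ_ : PT A Boolᵉ p → PT A Boolᵉ q → PT A Boolᵉ (λ n a → p n a ∨ q n a)
  P ∨ᵖ Q = ext (λ n a → lemma (p n a)) (ifᵖ P trueᵖ Q)
    where
    lemma : ∀ c {d} → c ∨ d ≡ (if c then true else d)
    lemma false = refl
    lemma true  = refl

unitᵖ : ∀ {A} → PT A ⊤ᵉ (λ _ _ → tt)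
unitᵖ = constᵖ nil (λ _ → refl)

consᵖ : ∀ {E} → PT (E ×ᵉ Listᵉ E) (Listᵉ E) (λ _ (e , l) → e ∷ l)
consᵖ {E} = recode {A = E ×ᵉ Listᵉ E} {E ×ᵉ Listᵉ E} (λ _ a → a) (λ _ _ → refl) (λ _ _ → refl) idᵖ

nilᵖ : ∀ {A E} → PT A (Listᵉ E) (λ _ _ → [])
nilᵖ = constᵖ nil (λ _ → refl)

tail′ : ∀ {X : Set} → List X → List X
tail′ []      = []
tail′ (_ ∷ l) = l

headOr : ∀ {X : Set} → X → List X → X
headOr d []      = d
headOr d (x ∷ _) = x

tailᵖ : ∀ {E} → PT (Listᵉ E) (Listᵉ E) (λ _ → tail′)
tailᵖ {E} = ext (λ _ → lemma) (caseᵖ {⊤ᵉ} {E} nilᵖ (sndᵖ ∘ᵖ sndᵖ) ∘ᵖ (unitᵖ ,ᵖ idᵖ))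
  where
  lemma : ∀ {X : Set} (l : List X) → tail′ l ≡ caseList l [] (λ _ l → l)
  lemma []      = refl
  lemma (_ ∷ _) = refl

headOrᵖ : ∀ {E} → PT (E ×ᵉ Listᵉ E) E (λ _ (d , l) → headOr d l)
headOrᵖ {E} = ext (λ _ (_ , l) → lemma l) (caseᵖ {E} {E} idᵖ (fstᵖ ∘ᵖ sndᵖ))
  where
  lemma : ∀ {X : Set} {d : X} (l : List X) → headOr d l ≡ caseList l d (λ x _ → x)
  lemma []      = refl
  lemma (_ ∷ _) = refl

nullᵖ : ∀ {E} → PT (Listᵉ E) Boolᵉ (λ _ → null)
nullᵖ {E} = ext (λ _ → lemma) (caseᵖ {⊤ᵉ} {E} trueᵖ falseᵖ ∘ᵖ (unitᵖ ,ᵖ idᵖ))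
  where
  lemma : ∀ {X : Set} (l : List X) → null l ≡ caseList l true (λ _ _ → false)
  lemma []      = refl
  lemma (_ ∷ _) = refl

-- The first list serves as a unary counter. Indexing and the comparison of numbers are both reduced
-- to this.
dropBy : ∀ {X Y : Set} → List X → List Y → List Y
dropBy k l = foldr (λ _ → tail′) l k

dropBy-[] : ∀ {X Y : Set} (k : List X) → dropBy {Y = Y} k [] ≡ []
dropBy-[] []      = refl
dropBy-[] (_ ∷ k) = cong tail′ (dropBy-[] k)

dropBy-∷ : ∀ {X Y : Set} {x : X} k {y : Y} {l} → dropBy (x ∷ k) (y ∷ l) ≡ dropBy k l
dropBy-∷ []      = refl
dropBy-∷ (x ∷ k) = cong tail′ (dropBy-∷ {x = x} k)

dropBy-size : ∀ {X : Set} {E n} (k : List X) (l : List (Car E n)) → sz (Listᵉ E) (dropBy k l) ≤ sz (Listᵉ E) l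
dropBy-size         []      l = ≤-refl
dropBy-size {E = E} (_ ∷ k) l = ≤-trans (tail-size (dropBy k l)) (dropBy-size {E = E} k l)
  where
  tail-size : ∀ m → sz (Listᵉ E) (tail′ m) ≤ sz (Listᵉ E) m
  tail-size []      = ≤-refl
  tail-size (x ∷ m) = m≤n⇒m≤1+n (m≤n+m _ (sz E x))

dropByᵖ : ∀ {D E} → PT (Listᵉ E ×ᵉ Listᵉ D) (Listᵉ E) (λ _ (l , k) → dropBy k l)
dropByᵖ {D} {E} = foldᵖ idᵖ (tailᵖ ∘ᵖ sndᵖ ∘ᵖ sndᵖ) X
  (λ n (l , k) → ≤-trans (dropBy-size {E = E} k l) (m≤n⇒m≤1+n (m≤m+n _ _)))

-- Each conjunct says that one list is at most as long as the other.
sameLength : ∀ {X Y : Set} → List X → List Y → Bool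
sameLength k l = null (dropBy k l) ∧ null (dropBy l k)

sameLength-replicate : ∀ {X Y : Set} {x : X} {y : Y} k l →
                       sameLength (replicate k x) (replicate l y) ≡ (k ≡ᵇ l)
sameLength-replicate zero    zero    = refl
sameLength-replicate zero    (suc l) = refl
sameLength-replicate (suc k) zero    = ∧-zeroʳ _
sameLength-replicate {x = x} {y} (suc k) (suc l) =
  trans (cong₂ (λ a b → null a ∧ null b) (dropBy-∷ {x = x} (replicate k x)) (dropBy-∷ {x = y} (replicate l y)))
        (sameLength-replicate k l)

sameLengthᵖ : ∀ {D E} → PT (Listᵉ D ×ᵉ Listᵉ E) Boolᵉ (λ _ (k , l) → sameLength k l)
sameLengthᵖ = (nullᵖ ∘ᵖ dropByᵖ ∘ᵖ (sndᵖ ,ᵖ fstᵖ)) ∧ᵖ (nullᵖ ∘ᵖ dropByᵖ)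

encodeℕ-replicate : ∀ k → encodeℕ k ≡ enc (Listᵉ ⊤ᵉ) {0} (replicate k tt)
encodeℕ-replicate k = cong encodeList (sym (map-replicate (λ _ → nil) k tt))

≡ᵇ-ᵖ : PT (ℕᵉ ×ᵉ ℕᵉ) Boolᵉ (λ _ (k , l) → k ≡ᵇ l)
≡ᵇ-ᵖ = recode (λ _ (k , l) → replicate k tt , replicate l tt)
  (λ _ (k , l) → cong₂ _∙_ (encodeℕ-replicate k) (encodeℕ-replicate l))
  (λ _ (k , l) → cong encodeBool (sym (sameLength-replicate k l))) (sameLengthᵖ {⊤ᵉ} {⊤ᵉ})

++ᵖ : ∀ {E} → PT (Listᵉ E ×ᵉ Listᵉ E) (Listᵉ E) (λ _ (k , l) → k ++ l)
++ᵖ {E} = ext (λ n (k , l) → lemma k l) (foldᵖ {Listᵉ E} {E} idᵖ (consᵖ ∘ᵖ sndᵖ) X bound ∘ᵖ (sndᵖ ,ᵖ fstᵖ))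
  where
  lemma : ∀ {X : Set} (k l : List X) → k ++ l ≡ foldr _∷_ l k
  lemma []      l = refl
  lemma (x ∷ k) l = cong (x ∷_) (lemma k l)
  bound : ∀ n ((l , k) : List (Car E n) × List (Car E n)) →
          sz (Listᵉ E) (foldr _∷_ l k) ≤ suc (sz (Listᵉ E) l + sz (Listᵉ E) k)
  bound n (l , [])    = m≤n⇒m≤1+n (m≤m+n _ 1)
  bound n (l , x ∷ k) = s≤s (begin
    sz E x + _          ≤⟨ +-monoʳ-≤ (sz E x) (bound n (l , k)) ⟩
    sz E x + suc (L + K) ≡⟨ +-suc (sz E x) _ ⟩
    suc (sz E x + (L + K)) ≡⟨ cong suc (x∙yz≈y∙xz +-commutativeSemigroup (sz E x) L K) ⟩
    suc (L + (sz E x + K)) ≡⟨ +-suc L _ ⟨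
    L + suc (sz E x + K) ∎)
    where
    open ≤-Reasoning
    L = sz (Listᵉ E) l
    K = sz (Listᵉ E) k

+ᵖ : PT (ℕᵉ ×ᵉ ℕᵉ) ℕᵉ (λ _ (k , l) → k + l)
+ᵖ = recode (λ _ (k , l) → replicate k tt , replicate l tt)
  (λ _ (k , l) → cong₂ _∙_ (encodeℕ-replicate k) (encodeℕ-replicate l))
  (λ _ (k , l) → trans (encodeℕ-replicate (k + l)) (cong (enc (Listᵉ ⊤ᵉ) {0}) (lemma k l)))
  (++ᵖ {⊤ᵉ})
  where
  lemma : ∀ k l → replicate (k + l) tt ≡ replicate k tt ++ replicate l tt
  lemma zero    l = refl
  lemma (suc k) l = cong (tt ∷_) (lemma k l)

module _ {C E B : Enc} {h : Fun (C ×ᵉ E) B} where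

  mapᵖ : PT (C ×ᵉ E) B h → PT (C ×ᵉ Listᵉ E) (Listᵉ B) (λ n (c , l) → map (λ e → h n (c , e)) l)
  mapᵖ H = ext (λ n (c , l) → lemma l) (foldᵖ {C} {E} {Listᵉ B} nilᵖ
      (consᵖ ∘ᵖ (H ∘ᵖ (fstᵖ ,ᵖ fstᵖ ∘ᵖ sndᵖ) ,ᵖ sndᵖ ∘ᵖ sndᵖ))
      (κ 1 ⊕ X ⊗ (κ 1 ⊕ out H))
      (λ n (c , l) → subst (λ m → sz (Listᵉ B) m ≤ _) (lemma l) (≤-trans (bound _ c l ≤-refl)
        (+-monoʳ-≤ 1 (*-monoˡ-≤ _ (≤-trans (length≤size {E} l) (m≤n⇒m≤1+n (m≤n+m _ (sz C c)))))))))
    where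
    lemma : ∀ {X Y : Set} {k : X → Y} l → map k l ≡ foldr (λ e acc → k e ∷ acc) [] l
    lemma []      = refl
    lemma (x ∷ l) = cong (_ ∷_) (lemma l)
    bound : ∀ s {n} (c : Car C n) l → sz (C ×ᵉ Listᵉ E) (c , l) ≤ s →
            sz (Listᵉ B) (map (λ e → h n (c , e)) l) ≤ 1 + length l * (1 + ⟦ out H ⟧ s)
    bound s c []      le = ≤-refl
    bound s c (e ∷ l) le = s≤s (begin
      sz B _ + sz (Listᵉ B) (map _ l)
        ≤⟨ +-mono-≤ (≤-trans (out≤ H _) (mono (out H) (≤-trans
             (s≤s (+-monoʳ-≤ (sz C c) (≤-trans (m≤m+n (sz E e) _) (n≤1+n _)))) le)))
           (bound s c l (≤-trans (s≤s (+-monoʳ-≤ (sz C c) (m≤n⇒m≤1+n (m≤n+m _ (sz E e))))) le)) ⟩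
      ⟦ out H ⟧ s + (1 + length l * (1 + ⟦ out H ⟧ s)) ≡⟨ +-suc (⟦ out H ⟧ s) _ ⟩
      suc (⟦ out H ⟧ s) + length l * (1 + ⟦ out H ⟧ s) ∎)
      where open ≤-Reasoning

filter-size : ∀ {E n} q (l : List (Car E n)) → sz (Listᵉ E) (filterᵇ q l) ≤ sz (Listᵉ E) l
filter-size     q []      = ≤-refl
filter-size {E} q (x ∷ l) with q x
... | true  = s≤s (+-monoʳ-≤ (sz E x) (filter-size {E} q l))
... | false = m≤n⇒m≤1+n (≤-trans (filter-size {E} q l) (m≤n+m _ (sz E x)))

encodeBool-size : ∀ b → size (encodeBool b) ≤ 3
encodeBool-size false = s≤s z≤n
encodeBool-size true  = ≤-refl

module _ {C E : Enc} {p : Fun (C ×ᵉ E) Boolᵉ} where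

  anyᵖ : PT (C ×ᵉ E) Boolᵉ p → PT (C ×ᵉ Listᵉ E) Boolᵉ (λ n (c , l) → any (λ e → p n (c , e)) l)
  anyᵖ P = ext (λ n (c , l) → lemma l) (foldᵖ {C} {E} {Boolᵉ} falseᵖ
      (P ∘ᵖ (fstᵖ ,ᵖ fstᵖ ∘ᵖ sndᵖ) ∨ᵖ sndᵖ ∘ᵖ sndᵖ) (κ 3) (λ _ _ → encodeBool-size _))
    where
    lemma : ∀ {X : Set} {q : X → Bool} l → any q l ≡ foldr (λ e acc → q e ∨ acc) false l
    lemma []      = refl
    lemma (x ∷ l) = cong (_ ∨_) (lemma l)

  allᵖ : PT (C ×ᵉ E) Boolᵉ p → PT (C ×ᵉ Listᵉ E) Boolᵉ (λ n (c , l) → all (λ e → p n (c , e)) l)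
  allᵖ P = ext (λ n (c , l) → lemma l) (foldᵖ {C} {E} {Boolᵉ} trueᵖ
      (P ∘ᵖ (fstᵖ ,ᵖ fstᵖ ∘ᵖ sndᵖ) ∧ᵖ sndᵖ ∘ᵖ sndᵖ) (κ 3) (λ _ _ → encodeBool-size _))
    where
    lemma : ∀ {X : Set} {q : X → Bool} l → all q l ≡ foldr (λ e acc → q e ∧ acc) true l
    lemma []      = refl
    lemma (x ∷ l) = cong (_ ∧_) (lemma l)

  filterᵖ : PT (C ×ᵉ E) Boolᵉ p → PT (C ×ᵉ Listᵉ E) (Listᵉ E) (λ n (c , l) → filterᵇ (λ e → p n (c , e)) l)
  filterᵖ P = ext (λ n (c , l) → lemma l) (foldᵖ {C} {E} {Listᵉ E} nilᵖ
      (ifᵖ (P ∘ᵖ (fstᵖ ,ᵖ fstᵖ ∘ᵖ sndᵖ)) (consᵖ ∘ᵖ sndᵖ) (sndᵖ ∘ᵖ sndᵖ)) X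
      (λ n (c , l) → subst (λ m → sz (Listᵉ E) m ≤ _) (lemma l)
        (≤-trans (filter-size {E} _ l) (m≤n⇒m≤1+n (m≤n+m _ (sz C c))))))
    where
    lemma : ∀ {X : Set} {q : X → Bool} l → filterᵇ q l ≡ foldr (λ e acc → if q e then e ∷ acc else acc) [] l
    lemma []      = refl
    lemma {q = q} (x ∷ l) with q x
    ... | true  = cong (x ∷_) (lemma l)
    ... | false = lemma l

cartesianProductᵖ : ∀ {D E} → PT (Listᵉ D ×ᵉ Listᵉ E) (Listᵉ (D ×ᵉ E)) (λ _ (k , l) → cartesianProduct k l)
cartesianProductᵖ {D} {E} = ext (λ n (k , l) → lemma k l)
  (foldᵖ {Listᵉ E} {D} {Listᵉ (D ×ᵉ E)} nilᵖ
    (++ᵖ ∘ᵖ (mapᵖ {D} {E} idᵖ ∘ᵖ (fstᵖ ∘ᵖ sndᵖ ,ᵖ fstᵖ) ,ᵖ sndᵖ ∘ᵖ sndᵖ))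
    -- With input size `s` there are at most `s` rows of at most `s` pairs; a pair with its list
    -- cell has size at most 2 + 2s.
    (κ 1 ⊕ X ⊗ (X ⊗ (κ 2 ⊕ X ⊕ X)))
    (λ n (l , k) → ≤-trans (≤-reflexive (cong (sz (Listᵉ (D ×ᵉ E))) (sym (lemma k l)))) (bound _ k l
      (≤-trans (length≤size {D} k) (m≤n⇒m≤1+n (m≤n+m _ _)))
      (m≤n⇒m≤1+n (m≤n+m _ (sz (Listᵉ E) l))) (m≤n⇒m≤1+n (m≤m+n _ _))))
  ∘ᵖ (sndᵖ ,ᵖ fstᵖ))
  where
  lemma : ∀ {X Y : Set} (k : List X) (l : List Y) →
          cartesianProduct k l ≡ foldr (λ x acc → map (x ,_) l ++ acc) [] k
  lemma []      l = refl
  lemma (x ∷ k) l = cong (map (x ,_) l ++_) (lemma k l)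

  DE = D ×ᵉ E

  ++-size : ∀ {n} (k l : List (Car DE n)) → suc (sz (Listᵉ DE) (k ++ l)) ≡ sz (Listᵉ DE) k + sz (Listᵉ DE) l
  ++-size []      l = refl
  ++-size (x ∷ k) l = cong suc (trans (sym (+-suc (sz DE x) _))
    (trans (cong (sz DE x +_) (++-size k l)) (sym (+-assoc (sz DE x) _ _))))

  row-size : ∀ s {n} (x : Car D n) (l : List (Car E n)) → sz D x ≤ s → sz (Listᵉ E) l ≤ s →
             sz (Listᵉ DE) (map (x ,_) l) ≤ suc (length l * (2 + (s + s)))
  row-size s x []      hx hl = ≤-refl
  row-size s x (y ∷ l) hx hl = s≤s (≤-trans (+-mono-≤
      (s≤s (+-mono-≤ hx (≤-trans (m≤m+n (sz E y) _) (≤-trans (n≤1+n _) hl))))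
      (row-size s x l hx (≤-trans (m≤n⇒m≤1+n (m≤n+m _ (sz E y))) hl)))
    (≤-reflexive (+-suc (suc (s + s)) _)))

  bound : ∀ s {n} (k : List (Car D n)) (l : List (Car E n)) → length k ≤ s → sz (Listᵉ D) k ≤ s →
          sz (Listᵉ E) l ≤ s → sz (Listᵉ DE) (cartesianProduct k l) ≤ 1 + s * (s * (2 + (s + s)))
  bound s k l hk hk′ hl = ≤-trans (rows k hk′) (s≤s (*-monoˡ-≤ _ hk))
    where
    rows : ∀ k → sz (Listᵉ D) k ≤ s → sz (Listᵉ DE) (cartesianProduct k l) ≤ 1 + length k * (s * (2 + (s + s)))
    rows []      h = ≤-refl
    rows (x ∷ k) h = ≤-pred (begin
      suc (sz (Listᵉ DE) (map (x ,_) l ++ cartesianProduct k l))     ≡⟨ ++-size (map (x ,_) l) _ ⟩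
      sz (Listᵉ DE) (map (x ,_) l) + sz (Listᵉ DE) (cartesianProduct k l)
        ≤⟨ +-mono-≤ (row-size s x l (≤-trans (m≤m+n (sz D x) _) (≤-trans (n≤1+n _) h)) hl)
                    (rows k (≤-trans (m≤n⇒m≤1+n (m≤n+m _ (sz D x))) h)) ⟩
      suc (length l * c) + suc (length k * (s * c))
        ≤⟨ +-monoˡ-≤ _ (s≤s (*-monoˡ-≤ c (≤-trans (length≤size {E} l) hl))) ⟩
      suc (s * c) + suc (length k * (s * c))                          ≡⟨ +-suc (suc (s * c)) _ ⟩
      2 + (s * c + length k * (s * c))                                ∎)
      where
      open ≤-Reasoning
      c = 2 + (s + s)

-- Graphs, vertices and subsets

Graphᵉ Finᵉ Subsetᵉ : Enc
Graphᵉ  = record { Car = λ n → Graph (Fin n) ; enc = encodeGraph }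
Finᵉ    = record { Car = Fin ; enc = λ i → encodeℕ (toℕ i) }
Subsetᵉ = record { Car = Subset ; enc = encodeSubset }

nth : ∀ {X Y : Set} → Y → List X → List Y → Y
nth d k l = headOr d (dropBy k l)

nth-tabulate : ∀ {Y : Set} d {n} (f : Fin n → Y) i → nth d (replicate (toℕ i) tt) (tabulate f) ≡ f i
nth-tabulate d f zero    = refl
nth-tabulate d f (suc i) = trans (cong (headOr d) (dropBy-∷ (replicate (toℕ i) tt))) (nth-tabulate d (f ∘ suc) i)

nthᵖ : ∀ {D E} x {d : ∀ n → Car E n} → (∀ n → enc E (d n) ≡ x) →
       PT (Listᵉ D ×ᵉ Listᵉ E) E (λ n (k , l) → nth (d n) k l)
nthᵖ x eq = headOrᵖ ∘ᵖ (constᵖ x eq ,ᵖ dropByᵖ ∘ᵖ (sndᵖ ,ᵖ fstᵖ))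

unaryᵖ : PT Finᵉ (Listᵉ ⊤ᵉ) (λ _ i → replicate (toℕ i) tt)
unaryᵖ = recode {A = Finᵉ} {Finᵉ} (λ _ a → a) (λ _ _ → refl) (λ n a → sym (encodeℕ-replicate (toℕ a))) idᵖ

rows : ∀ {n} → Graph (Fin n) → List (List Bool)
rows G = tabulate λ i → tabulate λ j → Graph.adj G i j

rowsᵖ : PT Graphᵉ (Listᵉ (Listᵉ Boolᵉ)) (λ _ → rows)
rowsᵖ = recode {A = Graphᵉ} {Graphᵉ} (λ _ a → a) (λ _ _ → refl) (λ n G → cong encodeList (encode-rows G)) idᵖ
  where
  encode-rows : ∀ {n} (G : Graph (Fin n)) → map (enc (Listᵉ Boolᵉ) {0}) (rows G) ≡
                (tabulate λ i → encodeList (tabulate λ j → encodeBool (Graph.adj G i j)))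
  encode-rows G = trans (map-tabulate _ (enc (Listᵉ Boolᵉ) {0}))
                    (tabulate-cong λ i → cong encodeList (map-tabulate _ encodeBool))

adjᵖ : PT (Graphᵉ ×ᵉ Finᵉ ×ᵉ Finᵉ) Boolᵉ (λ _ (G , u , v) → Graph.adj G u v)
adjᵖ = ext (λ n (G , u , v) → sym (trans
           (cong (nth false (replicate (toℕ v) tt)) (nth-tabulate [] (λ i → tabulate (Graph.adj G i)) u))
           (nth-tabulate false (Graph.adj G u) v)))
  (nthᵖ nil (λ _ → refl) ∘ᵖ (unaryᵖ ∘ᵖ sndᵖ ∘ᵖ sndᵖ ,ᵖ
    nthᵖ nil (λ _ → refl) ∘ᵖ (unaryᵖ ∘ᵖ fstᵖ ∘ᵖ sndᵖ ,ᵖ rowsᵖ ∘ᵖ fstᵖ)))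

∈-ᵖ : PT (Subsetᵉ ×ᵉ Finᵉ) Boolᵉ (λ _ (S , v) → lookup S v)
∈-ᵖ = ext (λ n (S , v) → lemma S v)
  (nthᵖ nil (λ _ → refl) ∘ᵖ (unaryᵖ ∘ᵖ sndᵖ ,ᵖ
    toListᵖ ∘ᵖ fstᵖ))
  where
  toListᵖ : PT Subsetᵉ (Listᵉ Boolᵉ) (λ _ → toList)
  toListᵖ = recode {A = Subsetᵉ} {Subsetᵉ} (λ _ a → a) (λ _ _ → refl) (λ _ _ → refl) idᵖ
  lemma : ∀ {n} (S : Subset n) v → lookup S v ≡ nth false (replicate (toℕ v) tt) (toList S)
  lemma (b ∷ S) zero    = refl
  lemma (b ∷ S) (suc v) = trans (lemma S v) (sym (cong (headOr false) (dropBy-∷ (replicate (toℕ v) tt))))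

-- The encoding of a graph does not contain its order as a number, so the unary numerals of the
-- vertices are produced from the list of matrix rows: 0, followed by the successors of the numerals
-- for the remaining rows.
naturals : ∀ {X : Set} → List X → List (List ⊤)
naturals = foldr (λ _ acc → [] ∷ map (tt ∷_) acc) []

naturals-tabulate : ∀ {X : Set} {n} (f : Fin n → X) →
                    naturals (tabulate f) ≡ map (λ i → replicate (toℕ i) tt) (allFin n)
naturals-tabulate {n = zero}  f = refl
naturals-tabulate {n = suc n} f = cong ([] ∷_) (trans (cong (map (tt ∷_)) (naturals-tabulate (f ∘ suc)))
  (trans (sym (map-∘ (allFin n))) (trans (map-tabulate id _) (sym (map-tabulate suc _)))))

naturalsᵖ : ∀ {E} → PT (Listᵉ E) (Listᵉ (Listᵉ ⊤ᵉ)) (λ _ → naturals)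
naturalsᵖ {E} = foldᵖ {⊤ᵉ} {E} {Listᵉ (Listᵉ ⊤ᵉ)} nilᵖ
    (consᵖ ∘ᵖ (nilᵖ ,ᵖ mapᵖ (consᵖ ∘ᵖ (unitᵖ ,ᵖ sndᵖ)) ∘ᵖ sndᵖ))
    -- The unary numeral of i has size 1 + 2i, and its list cell adds 1.
    (κ 1 ⊕ X ⊗ (κ 2 ⊕ (X ⊕ X)))
    (λ n (_ , l) → let h = ≤-trans (length≤size {E} l) (m≤n+m _ 2) in
      ≤-trans (bound _ l h) (s≤s (*-monoˡ-≤ _ h)))
  ∘ᵖ (unitᵖ ,ᵖ idᵖ)
  where
  NN = Listᵉ (Listᵉ ⊤ᵉ)
  length-naturals : ∀ {X : Set} (l : List X) → length (naturals l) ≡ length l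
  length-naturals []      = refl
  length-naturals (_ ∷ l) = cong suc (trans (length-map _ (naturals l)) (length-naturals l))
  map-size : ∀ m → sz NN {0} (map (tt ∷_) m) ≡ sz NN {0} m + (length m + length m)
  map-size []      = refl
  map-size (x ∷ m) = cong suc (begin
    2 + a + sz NN {0} (map (tt ∷_) m)  ≡⟨ cong (2 + a +_) (map-size m) ⟩
    2 + a + (b + (c + c))
      ≡⟨ solve 3 (λ a b c → con 2 :+ a :+ (b :+ (c :+ c)) := a :+ b :+ (con 1 :+ c :+ (con 1 :+ c))) refl a b c ⟩
    a + b + (suc c + suc c)            ∎)
    where
    open ≡-Reasoning
    open +-*-Solver using (solve; con; _:+_; _:=_)
    a = sz (Listᵉ ⊤ᵉ) {0} x
    b = sz NN {0} m
    c = length m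
  bound : ∀ s {X : Set} (l : List X) → length l ≤ s → sz NN {0} (naturals l) ≤ 1 + length l * (2 + (s + s))
  bound s []      h = ≤-refl
  bound s (_ ∷ l) h rewrite map-size (naturals l) | length-naturals l = s≤s (s≤s (begin
    sz NN {0} (naturals l) + (length l + length l)  ≤⟨ +-mono-≤ (bound s l l≤s) (+-mono-≤ l≤s l≤s) ⟩
    1 + length l * (2 + (s + s)) + (s + s)          ≡⟨ +-comm _ (s + s) ⟩
    s + s + (1 + length l * (2 + (s + s)))          ≡⟨ +-suc (s + s) _ ⟩
    1 + (s + s) + length l * (2 + (s + s))          ∎))
    where
    open ≤-Reasoning
    l≤s = ≤-trans (n≤1+n _) h

verticesᵖ : PT Graphᵉ (Listᵉ Finᵉ) (λ n _ → allFin n)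
verticesᵖ = recode {A = Graphᵉ} {Listᵉ (Listᵉ ⊤ᵉ)} {f = λ _ G → naturals (rows G)} (λ _ a → a) (λ _ _ → refl)
  (λ n G → cong encodeList (trans (map-cong (λ i → encodeℕ-replicate (toℕ i)) (allFin n))
     (trans (map-∘ (allFin n)) (cong (map (enc (Listᵉ ⊤ᵉ) {0})) (sym (naturals-tabulate _))))))
  (naturalsᵖ ∘ᵖ rowsᵖ)

-- Programs of the algorithm

Labelᵉ Literalᵉ Pairᵉ : Enc
Labelᵉ   = record { Car = λ _ → Label ; enc = λ α → encodeℕ (value α) }
Literalᵉ = Finᵉ ×ᵉ Labelᵉ
Pairᵉ    = Literalᵉ ×ᵉ Literalᵉ

toℕᵖ : PT Finᵉ ℕᵉ (λ _ → toℕ)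
toℕᵖ = recode {A = Finᵉ} {Finᵉ} (λ _ a → a) (λ _ _ → refl) (λ _ _ → refl) idᵖ

valueᵖ : PT Labelᵉ ℕᵉ (λ _ → value)
valueᵖ = recode {A = Labelᵉ} {Labelᵉ} (λ _ a → a) (λ _ _ → refl) (λ _ _ → refl) idᵖ

labelᵖ : ∀ {A} (α : Label) → PT A Labelᵉ (λ _ _ → α)
labelᵖ α = constᵖ (encodeℕ (value α)) (λ _ → refl)

sameVertexᵖ : PT (Literalᵉ ×ᵉ Literalᵉ) Boolᵉ (λ _ ((u , _) , (v , _)) → toℕ u ≡ᵇ toℕ v)
sameVertexᵖ = ≡ᵇ-ᵖ ∘ᵖ (toℕᵖ ∘ᵖ fstᵖ ∘ᵖ fstᵖ ,ᵖ toℕᵖ ∘ᵖ fstᵖ ∘ᵖ sndᵖ)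

sameLabelᵖ : PT (Literalᵉ ×ᵉ Literalᵉ) Boolᵉ (λ _ ((_ , α) , (_ , β)) → value α ≡ᵇ value β)
sameLabelᵖ = ≡ᵇ-ᵖ ∘ᵖ (valueᵖ ∘ᵖ sndᵖ ∘ᵖ fstᵖ ,ᵖ valueᵖ ∘ᵖ sndᵖ ∘ᵖ sndᵖ)

sameᵖ : PT (Literalᵉ ×ᵉ Literalᵉ) Boolᵉ (λ _ (p , q) → same p q)
sameᵖ = sameVertexᵖ ∧ᵖ sameLabelᵖ

compatibleᵖ : PT (Graphᵉ ×ᵉ Literalᵉ ×ᵉ Literalᵉ) Boolᵉ (λ _ (G , p , q) → compatible G p q)
compatibleᵖ =
  (notᵖ (sameVertexᵖ ∘ᵖ sndᵖ) ∨ᵖ sameLabelᵖ ∘ᵖ sndᵖ) ∧ᵖ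
  (notᵖ (adjᵖ ∘ᵖ (fstᵖ ,ᵖ fstᵖ ∘ᵖ fstᵖ ∘ᵖ sndᵖ ,ᵖ fstᵖ ∘ᵖ sndᵖ ∘ᵖ sndᵖ)) ∨ᵖ
   notᵖ (≡ᵇ-ᵖ ∘ᵖ
     (+ᵖ ∘ᵖ (valueᵖ ∘ᵖ sndᵖ ∘ᵖ fstᵖ ,ᵖ valueᵖ ∘ᵖ sndᵖ ∘ᵖ sndᵖ) ∘ᵖ sndᵖ ,ᵖ constᵖ (encodeℕ 2) (λ _ → refl))))

memberᵖ : PT (Listᵉ Pairᵉ ×ᵉ Pairᵉ) Boolᵉ (λ _ (R , (p , q)) → member R p q)
memberᵖ = anyᵖ (sameᵖ ∘ᵖ (fstᵖ ∘ᵖ fstᵖ ,ᵖ fstᵖ ∘ᵖ sndᵖ) ∧ᵖ sameᵖ ∘ᵖ (sndᵖ ∘ᵖ fstᵖ ,ᵖ sndᵖ ∘ᵖ sndᵖ)) ∘ᵖ (sndᵖ ,ᵖ fstᵖ)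

State : Enc
State = Graphᵉ ×ᵉ Listᵉ Literalᵉ ×ᵉ Listᵉ Pairᵉ

supportedᵖ : PT (State ×ᵉ Pairᵉ) Boolᵉ (λ _ ((G , F , R) , (p , q)) → supported G F R p q)
supportedᵖ =
  compatibleᵖ ∘ᵖ (fstᵖ ∘ᵖ fstᵖ ,ᵖ sndᵖ) ∧ᵖ
  allᵖ compatible-withᵖ ∘ᵖ ((fstᵖ ∘ᵖ fstᵖ ,ᵖ fstᵖ ∘ᵖ sndᵖ) ,ᵖ fstᵖ ∘ᵖ sndᵖ ∘ᵖ fstᵖ) ∧ᵖ
  allᵖ (anyᵖ linkedᵖ ∘ᵖ (idᵖ ,ᵖ constᵖ (enc (Listᵉ Labelᵉ) {0} labels) {λ _ → labels} (λ _ → refl))) ∘ᵖ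
    ((sndᵖ ∘ᵖ sndᵖ ∘ᵖ fstᵖ ,ᵖ sndᵖ) ,ᵖ verticesᵖ ∘ᵖ fstᵖ ∘ᵖ fstᵖ)
  where
  compatible-withᵖ : PT ((Graphᵉ ×ᵉ Literalᵉ) ×ᵉ Literalᵉ) Boolᵉ (λ _ ((G , p) , q) → compatible G p q)
  compatible-withᵖ = compatibleᵖ ∘ᵖ (fstᵖ ∘ᵖ fstᵖ ,ᵖ sndᵖ ∘ᵖ fstᵖ ,ᵖ sndᵖ)

  linkedᵖ : PT (((Listᵉ Pairᵉ ×ᵉ Pairᵉ) ×ᵉ Finᵉ) ×ᵉ Labelᵉ) Boolᵉ
               (λ _ (((R , (p , q)) , w) , γ) → member R p (w , γ) ∧ member R q (w , γ))
  linkedᵖ =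
    memberᵖ ∘ᵖ (fstᵖ ∘ᵖ fstᵖ ∘ᵖ fstᵖ ,ᵖ fstᵖ ∘ᵖ sndᵖ ∘ᵖ fstᵖ ∘ᵖ fstᵖ ,ᵖ (sndᵖ ∘ᵖ fstᵖ ,ᵖ sndᵖ)) ∧ᵖ
    memberᵖ ∘ᵖ (fstᵖ ∘ᵖ fstᵖ ∘ᵖ fstᵖ ,ᵖ sndᵖ ∘ᵖ sndᵖ ∘ᵖ fstᵖ ∘ᵖ fstᵖ ,ᵖ (sndᵖ ∘ᵖ fstᵖ ,ᵖ sndᵖ))

refineAllᵖ : PT State (Listᵉ Pairᵉ) (λ _ (G , F , R) → refineAll G F R)
-- The bound `X` suffices for the accumulator, since every iterate arises from `R` by filtering.
refineAllᵖ = foldᵖ {State} {Pairᵉ} (sndᵖ ∘ᵖ sndᵖ) (refineᵖ ∘ᵖ (fstᵖ ∘ᵖ fstᵖ ,ᵖ fstᵖ ∘ᵖ sndᵖ ∘ᵖ fstᵖ ,ᵖ sndᵖ ∘ᵖ sndᵖ)) X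
    (λ n ((G , F , R) , l) → ≤-trans (shrinks G F R l) 
      (m≤n⇒m≤1+n (≤-trans (m≤n⇒m≤1+n (≤-trans
        (m≤n⇒m≤1+n (m≤n+m _ (sz (Listᵉ Literalᵉ) F))) (m≤n+m _ (sz Graphᵉ G)))) (m≤m+n _ (sz (Listᵉ Pairᵉ) l)))))
  ∘ᵖ (idᵖ ,ᵖ sndᵖ ∘ᵖ sndᵖ)
  where
  refineᵖ : PT State (Listᵉ Pairᵉ) (λ _ (G , F , R) → refine G F R)
  refineᵖ = filterᵖ supportedᵖ ∘ᵖ (idᵖ ,ᵖ sndᵖ ∘ᵖ sndᵖ)

  shrinks : ∀ {n} (G : Graph (Fin n)) F R l →
            sz (Listᵉ Pairᵉ) (foldr {A = Literal n × Literal n} (λ _ → refine G F) R l) ≤ sz (Listᵉ Pairᵉ) R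
  shrinks G F R []      = ≤-refl
  shrinks G F R (_ ∷ l) = ≤-trans (filter-size {Pairᵉ} _ _) (shrinks G F R l)

pathConsistentᵖ : PT (Graphᵉ ×ᵉ Listᵉ Literalᵉ) Boolᵉ (λ _ (G , F) → pathConsistent G F)
pathConsistentᵖ = notᵖ (nullᵖ ∘ᵖ refineAllᵖ ∘ᵖ (fstᵖ ,ᵖ sndᵖ ,ᵖ cartesianProductᵖ ∘ᵖ (idᵖ ,ᵖ idᵖ) ∘ᵖ literalsᵖ ∘ᵖ fstᵖ))
  where
  literalsᵖ : PT Graphᵉ (Listᵉ Literalᵉ) (λ n _ → literals n)
  literalsᵖ = cartesianProductᵖ ∘ᵖ (verticesᵖ ,ᵖ constᵖ (enc (Listᵉ Labelᵉ) {0} labels) {λ _ → labels} (λ _ → refl))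

separableᵖ : PT (Graphᵉ ×ᵉ Listᵉ Literalᵉ) Boolᵉ (λ _ (G , F) → separable G F)
separableᵖ = anyᵖ (anyᵖ testᵖ ∘ᵖ (idᵖ ,ᵖ verticesᵖ ∘ᵖ fstᵖ ∘ᵖ fstᵖ)) ∘ᵖ (idᵖ ,ᵖ verticesᵖ ∘ᵖ fstᵖ)
  where
  testᵖ : PT (((Graphᵉ ×ᵉ Listᵉ Literalᵉ) ×ᵉ Finᵉ) ×ᵉ Finᵉ) Boolᵉ
             (λ _ (((G , F) , a) , b) → pathConsistent G ((a , left) ∷ (b , right) ∷ F))
  testᵖ = pathConsistentᵖ ∘ᵖ (fstᵖ ∘ᵖ fstᵖ ∘ᵖ fstᵖ ,ᵖ
    consᵖ ∘ᵖ ((sndᵖ ∘ᵖ fstᵖ ,ᵖ labelᵖ left) ,ᵖ consᵖ ∘ᵖ ((sndᵖ ,ᵖ labelᵖ right) ,ᵖ sndᵖ ∘ᵖ fstᵖ ∘ᵖ fstᵖ)))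

prepareᵖ : PT (Graphᵉ ×ᵉ Subsetᵉ) (Graphᵉ ×ᵉ Listᵉ Literalᵉ ×ᵉ Listᵉ Finᵉ) (λ _ (G , S) → G , [] , vertices S)
prepareᵖ = fstᵖ ,ᵖ nilᵖ ,ᵖ filterᵖ ∈-ᵖ ∘ᵖ (sndᵖ ,ᵖ verticesᵖ ∘ᵖ fstᵖ)

-- The branching recursion

module Branch {C E : Enc} {leaf : Fun (C ×ᵉ Listᵉ (E ×ᵉ Labelᵉ)) Boolᵉ}
              (L : PT (C ×ᵉ Listᵉ (E ×ᵉ Labelᵉ)) Boolᵉ leaf) where

  or₃ᵖ : PT (Boolᵉ ×ᵉ Boolᵉ ×ᵉ Boolᵉ) Boolᵉ (λ _ (a , b , c) → a ∨ b ∨ c)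
  or₃ᵖ = fstᵖ ∨ᵖ fstᵖ ∘ᵖ sndᵖ ∨ᵖ sndᵖ ∘ᵖ sndᵖ

  Input : Enc
  Input = C ×ᵉ Listᵉ (E ×ᵉ Labelᵉ) ×ᵉ Listᵉ E

  -- After three nested cases the seven variables are `x`, `xs`, `F`, `x ∷ xs`, `c`, the pair of `F`
  -- and `x ∷ xs`, and the whole input.
  recurse : Label → Exp (suc (k L + k or₃ᵖ)) 7
  recurse α = call zero (var (suc (suc (suc (suc zero)))) ∙
    (((var zero ∙ quoted (encodeℕ (value α))) ∙ var (suc (suc zero))) ∙ var (suc zero)))

  table′ : Table (suc (k L + k or₃ᵖ))
  table′ = link (table L) (table or₃ᵖ)
    (case (var zero) nil (case (var (suc zero)) nil (case (var (suc zero))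
      (call (suc (entry L ↑ˡ k or₃ᵖ)) (var (suc (suc zero)) ∙ var zero))
      (call (suc (k L ↑ʳ entry or₃ᵖ)) (recurse left ∙ (recurse cut ∙ recurse right))))))

  -- The numerical constants in this module are generous.
  steps : Pol
  steps = κ 100 ⊕ time L ⊚ (κ 1 ⊕ X) ⊕ κ (100 + ⟦ time or₃ᵖ ⟧ 11)

  -- The 11 bounds the size of a triple of Booleans: three trees of size at most 3 and two pair
  -- nodes.
  c₀ : ℕ
  c₀ = 100 + ⟦ time or₃ᵖ ⟧ 11

  cost : ℕ → ℕ → ℕ
  cost s zero    = 100 + ⟦ time L ⟧ (1 + s)
  cost s (suc m) = c₀ + 3 * cost s m

  -- The added `c₀` strengthens the induction: c₀ + 3t + c₀ is at most 3 (t + c₀), so the overhead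
  -- of each node is absorbed and exactly `3 ^ m` remains as a factor.
  cost≤ : ∀ s m → cost s m + c₀ ≤ 3 ^ m * ⟦ steps ⟧ s
  cost≤ s zero    = ≤-reflexive (trans (+-assoc 100 (⟦ time L ⟧ (1 + s)) c₀) (sym (*-identityˡ (⟦ steps ⟧ s))))
  cost≤ s (suc m) = begin
    c₀ + 3 * t + c₀           ≤⟨ m≤m+n _ c₀ ⟩
    c₀ + 3 * t + c₀ + c₀      ≡⟨ solve 2 (λ x y → x :+ con 3 :* y :+ x :+ x := con 3 :* (y :+ x)) refl c₀ t ⟩
    3 * (t + c₀)              ≤⟨ *-monoʳ-≤ 3 (cost≤ s m) ⟩
    3 * (3 ^ m * ⟦ steps ⟧ s) ≡⟨ *-assoc 3 (3 ^ m) _ ⟨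
    3 ^ suc m * ⟦ steps ⟧ s   ∎
    where
    open ≤-Reasoning
    open +-*-Solver using (solve; con; _:+_; _:*_; _:=_)
    t = cost s m

  -- Labelling a vertex moves it from xs to F; the factor 8 pays for its label.
  weight : ∀ {n} → Car Input n → ℕ
  weight (c , F , xs) = sz C c + (sz (Listᵉ (E ×ᵉ Labelᵉ)) F + 8 * sz (Listᵉ E) xs)

  run′ : ∀ s {n} (c : Car C n) F xs → weight (c , F , xs) ≤ s →
         Eval≤ table′ (enc Input (c , F , xs) ∷ []) (table′ zero)
               (encodeBool (branch (λ F → leaf n (c , F)) F xs)) (cost s (length xs))
  run′ s c F [] h =
    weaken (+-mono-≤ (m≤m+n 10 90) (mono (time L) (s≤s (≤-trans
             (+-monoʳ-≤ (sz C c) (m≤m+n (sz (Listᵉ (E ×ᵉ Labelᵉ)) F) 8)) h))))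
      (case-∙≤ (var≤ _) (case-∙≤ (var≤ _) (case-nil≤ (var≤ _)
        (callˡ (var≤ _ ∙≤ var≤ _) (run L (c , F))))))
  run′ s {n} c F (x ∷ xs) h =
    weaken (begin
      22 + (t + (15 + t + (14 + t))) + ⟦ time or₃ᵖ ⟧ 11
        ≡⟨ solve 2 (λ x y → con 22 :+ (x :+ (con 15 :+ x :+ (con 14 :+ x))) :+ y := con 51 :+ y :+ con 3 :* x) refl t _ ⟩
      51 + ⟦ time or₃ᵖ ⟧ 11 + 3 * t
        ≤⟨ +-monoˡ-≤ (3 * t) (+-monoˡ-≤ (⟦ time or₃ᵖ ⟧ 11) (m≤m+n 51 49)) ⟩
      c₀ + 3 * t ∎)
      (case-∙≤ (var≤ _) (case-∙≤ (var≤ _) (case-∙≤ (var≤ _)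
        (callʳ (rec left ∙≤ (rec cut ∙≤ rec right))
          (weaken (mono (time or₃ᵖ) (bools≤ (result left) (result cut) (result right)))
            (run or₃ᵖ {n} _))))))
    where
    open ≤-Reasoning
    open +-*-Solver using (solve; con; _:+_; _:*_; _:=_)
    t = cost s (length xs)
    result : Label → Bool
    result α = branch (λ F → leaf n (c , F)) ((x , α) ∷ F) xs
    bools≤ : ∀ a b c → sz (Boolᵉ ×ᵉ Boolᵉ ×ᵉ Boolᵉ) {n} (a , b , c) ≤ 11
    bools≤ a b c = s≤s (+-mono-≤ (encodeBool-size a) (s≤s (+-mono-≤ (encodeBool-size b) (encodeBool-size c))))
    value≤ : ∀ α → size (encodeℕ (value α)) ≤ 5
    value≤ left  = s≤s z≤n
    value≤ cut   = s≤s (s≤s (s≤s z≤n))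
    value≤ right = ≤-refl
    weight≤ : ∀ α → weight (c , (x , α) ∷ F , xs) ≤ s
    -- With `e` the size of the vertex, the new entry of `F` adds at most 7 + e, while its removal
    -- from `xs` frees 8 (1 + e).
    weight≤ α = ≤-trans (+-monoʳ-≤ (sz C c) (begin
      2 + (e + size (encodeℕ (value α))) + f + 8 * l  ≤⟨ +-monoˡ-≤ (8 * l) (+-monoˡ-≤ f (+-monoʳ-≤ 2 (+-monoʳ-≤ e (value≤ α)))) ⟩
      2 + (e + 5) + f + 8 * l                         ≤⟨ m≤m+n _ (1 + 7 * e) ⟩
      2 + (e + 5) + f + 8 * l + (1 + 7 * e)
        ≡⟨ solve 3 (λ e f l → con 2 :+ (e :+ con 5) :+ f :+ con 8 :* l :+ (con 1 :+ con 7 :* e) :=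
                              f :+ con 8 :* (con 1 :+ (e :+ l))) refl e f l ⟩
      f + 8 * suc (e + l)                             ∎)) h
      where
      e = sz E x
      f = sz (Listᵉ (E ×ᵉ Labelᵉ)) F
      l = sz (Listᵉ E) xs
    rec : ∀ α → Eval≤ table′
      (enc E x ∷ enc (Listᵉ E) xs ∷ enc (Listᵉ (E ×ᵉ Labelᵉ)) F ∷ enc (Listᵉ E) (x ∷ xs) ∷ enc C c ∷
       enc (Listᵉ (E ×ᵉ Labelᵉ) ×ᵉ Listᵉ E) (F , x ∷ xs) ∷ enc Input (c , F , x ∷ xs) ∷ [])
      (recurse α) (encodeBool (result α)) (14 + t)
    rec α = call≤ (var≤ _ ∙≤ (((var≤ _ ∙≤ weaken (value≤ α) (quoted≤ (encodeℕ (value α)))) ∙≤ var≤ _) ∙≤ var≤ _))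
      (run′ s c ((x , α) ∷ F) xs (weight≤ α))

  branch-run : ∀ {n} (c : Car C n) F xs →
               Eval≤ table′ (enc Input (c , F , xs) ∷ []) (table′ zero)
                     (encodeBool (branch (λ F → leaf n (c , F)) F xs))
                     (3 ^ length xs * ⟦ steps ⊚ (κ 8 ⊗ X) ⟧ (sz Input (c , F , xs)))
  branch-run c F xs = weaken (≤-trans (m≤m+n _ c₀) (cost≤ _ (length xs))) (run′ _ c F xs (begin
      sz C c + (f + 8 * l)       ≤⟨ +-mono-≤ (m≤n*m (sz C c) 8) (+-monoˡ-≤ (8 * l) (m≤n*m f 8)) ⟩
      8 * sz C c + (8 * f + 8 * l) ≤⟨ m≤m+n _ 16 ⟩
      8 * sz C c + (8 * f + 8 * l) + 16
        ≡⟨ solve 3 (λ c f l → con 8 :* c :+ (con 8 :* f :+ con 8 :* l) :+ con 16 :=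
                              con 8 :* (con 1 :+ (c :+ (con 1 :+ (f :+ l))))) refl (sz C c) f l ⟩
      8 * sz Input (c , F , xs)  ∎))
    where
    open ≤-Reasoning
    open +-*-Solver using (solve; con; _:+_; _:*_; _:=_)
    f = sz (Listᵉ (E ×ᵉ Labelᵉ)) F
    l = sz (Listᵉ E) xs

  module _ {D : Enc} {init : Fun D Input} (H : PT D Input init) where

    answer : ∀ {n} → Car D n → Bool
    answer {n} d = let (c , F , xs) = init n d in branch (λ F → leaf n (c , F)) F xs

    branches : ∀ {n} → Car D n → ℕ
    branches {n} d = let (c , F , xs) = init n d in 3 ^ length xs

    table″ : Table (suc (suc (k L + k or₃ᵖ) + k H))
    table″ = link table′ (table H)
      (call (suc (zero ↑ˡ k H)) (call (suc (suc (k L + k or₃ᵖ) ↑ʳ entry H)) (var zero)))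

    steps″ : Pol
    steps″ = κ 3 ⊕ time H ⊕ (steps ⊚ (κ 8 ⊗ X)) ⊚ out H

    answer-run : ∀ {n} (d : Car D n) →
                 Eval≤ table″ (enc D d ∷ []) (table″ zero) (encodeBool (answer d)) (branches d * ⟦ steps″ ⟧ (sz D d))
    answer-run {n} d = let (c , F , xs) = init n d; b = branches d; h = ⟦ time H ⟧ (sz D d)
                           bounded = mono (steps ⊚ (κ 8 ⊗ X)) (out≤ H d) in
      weaken (≤-trans (+-mono-≤ (m≤n*m (3 + h) b {{m^n≢0 3 (length xs)}}) (*-monoʳ-≤ b bounded))
               (≤-reflexive (trans (sym (*-distribˡ-+ b (3 + h) _)) (cong (b *_) (+-assoc 3 h _)))))
             (callˡ (callʳ (var≤ zero) (run H d)) (branch-run c F xs))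

-- Composition with the algorithm for chordal deletion

vertices-length : ∀ {n} (S : Subset n) → length (vertices S) ≡ ∣ S ∣
vertices-length S = lemma {R = S} S id (λ _ → refl)
  where
  -- The filter keeps referring to the whole subset `R` while the induction consumes `S`; `f` places
  -- the positions of `S` among those of `R`.
  lemma : ∀ {n m} {R : Subset m} (S : Subset n) (f : Fin n → Fin m) → (∀ i → lookup R (f i) ≡ lookup S i) →
          length (filterᵇ (lookup R) (tabulate f)) ≡ ∣ S ∣
  lemma []      f h = refl
  lemma {R = R} (b ∷ S) f h rewrite h zero with b
  ... | true  = cong suc (lemma {R = R} S (f ∘ suc) (h ∘ suc))
  ... | false = lemma {R = R} S (f ∘ suc) (h ∘ suc)

subset-size : ∀ {n} (S : Subset n) → sz Subsetᵉ S ≤ 1 + n * 4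
subset-size []      = ≤-refl
subset-size (b ∷ S) = s≤s (+-mono-≤ (encodeBool-size b) (subset-size S))

order≤size : ∀ {n} (G : Graph (Fin n)) → n ≤ sz Graphᵉ G
order≤size G = subst (_≤ sz Graphᵉ G) (length-tabulate _) (list≤ (tabulate _))
  where
  list≤ : ∀ l → length l ≤ size (encodeList l)
  list≤ []      = z≤n
  list≤ (x ∷ l) = s≤s (≤-trans (list≤ l) (m≤n+m _ (size x)))

module Sequence (P : Program) {k} (b : Table (suc k)) where
  open Program P

  -- The main expression of `P` becomes a function, so that it can be called on the whole input. The
  -- second program then receives the graph with the deletion found in place of `ℓ`.
  first : Exp _ 1
  first = rename (λ h → suc (h ↑ˡ suc k)) main

  table₀ : Table _
  table₀ = link body b first

  program : Program
  program = record
    { functions = _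
    ; body      = table₀
    ; main      = case (var zero) nil
                    (call (suc (functions ↑ʳ zero)) (var zero ∙ call zero (var (suc (suc zero)))))
    }

  program-run : ∀ {x y z v s t} → Runs P (x ∙ y) z s → Eval≤ b ((x ∙ z) ∷ []) (b zero) v t →
                ∃ λ u → Runs program (x ∙ y) v u × u ≤ 7 + (s + t)
  program-run {s = s} {t} p q = case-∙≤ (var≤ _) (callʳ (var≤ _ ∙≤ call≤ (var≤ _)
    (_ , Eval-rename (link-embedsˡ body b first) p , ≤-refl)) q)

module _ {leaf : Fun (Graphᵉ ×ᵉ Listᵉ (Finᵉ ×ᵉ Labelᵉ)) Boolᵉ} (L : PT (Graphᵉ ×ᵉ Listᵉ (Finᵉ ×ᵉ Labelᵉ)) Boolᵉ leaf)
         (H : PT (Graphᵉ ×ᵉ Subsetᵉ) (Graphᵉ ×ᵉ Listᵉ Literalᵉ ×ᵉ Listᵉ Finᵉ) (λ _ (G , S) → G , [] , vertices S))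
         (correct : ∀ {n} (G : Graph (Fin n)) S → IsChordalDeletion G S →
                    branch (λ F → leaf n (G , F)) [] (vertices S) ≡ true ⇔ HasIndependentCutset G)
         where

  solvable : (f : ℕ → ℕ) → SolvableInO* ChordalDeletion f → SolvableInO* IndependentCutset (λ ℓ → f ℓ + 3 ^ ℓ)
  solvable f (P , c , d , solves) =
    program , c + c′ , d + d′ , λ x →
      let open IndependentCutsetInstance x
          y , t , runs , (S , y≡ , ∣S∣ , chordal) , t≤ = solves underlying
          u , runs′ , u≤ = program-run (subst (λ y → Runs P _ y t) y≡ runs) (B.answer-run H (graph , S))
      in encodeBool (B.answer H (graph , S)) , u , runs′ , (_ , refl , correct graph S chordal) ,
         time≤ graph S ℓ ∣S∣ t≤ u≤
    where
    module B = Branch {Graphᵉ} {Finᵉ} L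
    open Sequence P (B.table″ H)
    -- The 7 is the overhead of `program-run`. For input size `s`, graph and deletion together have
    -- size at most 2 + 5s: the graph at most `s`, the characteristic vector at most 1 + 4s, and a
    -- pair node.
    q = κ 7 ⊕ B.steps″ H ⊚ (κ 2 ⊕ X ⊗ κ 5)
    c′ = proj₁ (monomial-bound q)
    d′ = proj₁ (proj₂ (monomial-bound q))

    time≤ : ∀ {n} (G : Graph (Fin n)) (S : Subset n) ℓ {t u} → ∣ S ∣ ≡ ℓ →
            let s = size (encodeGraph G ∙ encodeℕ ℓ) in
            t ≤ c * s ^ d * f ℓ →
            u ≤ 7 + (t + B.branches H (G , S) * ⟦ B.steps″ H ⟧ (sz (Graphᵉ ×ᵉ Subsetᵉ) (G , S))) →
            u ≤ (c + c′) * s ^ (d + d′) * (f ℓ + 3 ^ ℓ)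
    time≤ {n} G S ℓ {t} {u} eq t≤ u≤ = begin
      u                                        ≤⟨ u≤ ⟩
      7 + (t + B.branches H (G , S) * r)       ≡⟨ cong (λ l → 7 + (t + 3 ^ l * r)) (trans (vertices-length S) eq) ⟩
      7 + (t + 3 ^ ℓ * r)                      ≤⟨ +-mono-≤ (m≤n*m 7 (3 ^ ℓ) {{m^n≢0 3 ℓ}})
                                                    (+-mono-≤ t≤ (*-monoʳ-≤ (3 ^ ℓ) (mono (B.steps″ H) input≤))) ⟩
      3 ^ ℓ * 7 + (c * s ^ d * f ℓ + 3 ^ ℓ * ⟦ B.steps″ H ⟧ (2 + s * 5))
        ≡⟨ solve 3 (λ w x y → w :* con 7 :+ (x :+ w :* y) := x :+ (con 7 :+ y) :* w) refl (3 ^ ℓ) (c * s ^ d * f ℓ) _ ⟩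
      c * s ^ d * f ℓ + ⟦ q ⟧ s * 3 ^ ℓ        ≤⟨ +-mono-≤ (*-monoˡ-≤ (f ℓ) (*-mono-≤ (m≤m+n c c′) (^-monoʳ-≤ s (m≤m+n d d′))))
                                                    (*-monoˡ-≤ (3 ^ ℓ) (≤-trans (proj₂ (proj₂ (monomial-bound q)) _)
                                                      (*-mono-≤ (m≤n+m c′ c) (^-monoʳ-≤ s (m≤n+m d′ d))))) ⟩
      (c + c′) * s ^ (d + d′) * f ℓ + (c + c′) * s ^ (d + d′) * 3 ^ ℓ
                                               ≡⟨ *-distribˡ-+ ((c + c′) * s ^ (d + d′)) (f ℓ) (3 ^ ℓ) ⟨
      (c + c′) * s ^ (d + d′) * (f ℓ + 3 ^ ℓ)  ∎
      where
      open ≤-Reasoning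
      open +-*-Solver using (solve; con; _:+_; _:*_; _:=_)
      s = size (encodeGraph G ∙ encodeℕ ℓ)
      r = ⟦ B.steps″ H ⟧ (sz (Graphᵉ ×ᵉ Subsetᵉ) (G , S))
      g≤s : sz Graphᵉ G ≤ s
      g≤s = m≤n⇒m≤1+n (m≤m+n _ _)
      input≤ : sz (Graphᵉ ×ᵉ Subsetᵉ) (G , S) ≤ 2 + s * 5
      input≤ = begin
        suc (sz Graphᵉ G + sz Subsetᵉ S)
          ≤⟨ s≤s (+-mono-≤ g≤s (≤-trans (subset-size S) (s≤s (*-monoˡ-≤ 4 (≤-trans (order≤size G) g≤s))))) ⟩
        suc (s + suc (s * 4))
          ≡⟨ solve 1 (λ x → con 1 :+ (x :+ (con 1 :+ x :* con 4)) := con 2 :+ x :* con 5) refl s ⟩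
        2 + s * 5                        ∎

corollary4p11 : (f : ℕ → ℕ) → SolvableInO* ChordalDeletion f → SolvableInO* IndependentCutset (λ ℓ → f ℓ + 3 ^ ℓ)
corollary4p11 = solvable separableᵖ prepareᵖ branch-separable
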